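{- The logic $\mathsf{IK4}$ has the finite model property: for every formula $\varphi\in\mathbb L$, if $\mathsf{IK4}\nvdash\varphi$, then there is an intuitionistic transitive model $\mathcal M$ with finite domain which falsifies $\varphi$, i.e. there is $w\in|\mathcal M|$ with $\mathcal M\not\models\varphi(w)$.
   Context: **Language.** Fix a countably infinite set $\mathbb P$ of propositional variables. The language $\mathbb L$ is given by $\varphi,\psi ::= p\mid\bot\mid(\varphi\wedge\psi)\mid(\varphi\vee\psi)\mid(\varphi\to\psi)\mid\Diamond\varphi\mid\Box\varphi$ with $p\in\mathbb P$; $\neg\varphi:=\varphi\to\bot$. **Logic.** $\mathsf{IK4}$ is the smallest set of formulas of $\mathbb L$ that contains all (substitution instances of) intuitionistic propositional tautologies and all substitution instances of the axioms $\Box(p\to q)\to(\Box p\to\Box q)$; $\Box(p\to q)\to(\Diamond p\to\Diamond q)$; $\Diamond(p\vee q)\to\Diamond p\vee\Diamond q$; $(\Diamond p\to\Box q)\to\Box(p\to q)$; $\neg\Diamond\bot$; $\Diamond\Diamond p\to\Diamond p$; $\Box p\to\Box\Box p$; and is closed under modus ponens and necessitation (from $\varphi$ infer $\Box\varphi$). $\mathsf{IK4}\vdash\varphi$ means $\varphi\in\mathsf{IK4}$. **Models.** An intuitionistic transitive model is a tuple $\mathcal M=(|\mathcal M|,\preccurlyeq,\sqsubset,[\![\cdot]\!])$ where $\sqsubset$ is a transitive relation on $|\mathcal M|$, $\preccurlyeq$ is a partial order on $|\mathcal M|$ that is expansive over $\sqsubset$, meaning: (forward confluence) if $x\sqsubset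 y$ and $x\preccurlyeq x'$ then there is $y'$ with $y\preccurlyeq y'$ and $x'\sqsubset y'$; (backward confluence) if $x\sqsubset y$ and $y\preccurlyeq y'$ then there is $x'$ with $x\preccurlyeq x'$ and $x'\sqsubset y'$; and $[\![\cdot]\!]:\mathbb P\to 2^{|\mathcal M|}$ is persistent: if $w\in[\![p]\!]$ and $w\preccurlyeq v$ then $v\in[\![p]\!]$. **Truth.** $\mathcal M\models\varphi(w)$ is defined by: $\mathcal M\models p(w)$ iff $w\in[\![p]\!]$; $\bot$ is never true; $\wedge,\vee$ are evaluated pointwise; $\mathcal M\models(\varphi\to\psi)(w)$ iff for all $v$ with $w\preccurlyeq v$, $\mathcal M\not\models\varphi(v)$ or $\mathcal M\models\psi(v)$; $\mathcal M\models\Diamond\varphi(w)$ iff there is $v$ with $w\sqsubset v$ and $\mathcal M\models\varphi(v)$; $\mathcal M\models\Box\varphi(w)$ iff $\mathcal M\models\varphi(v)$ for all $u,v$ with $w\preccurlyeq u\sqsubset v$. -}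

module Defs where

open import Data.Empty using (⊥)
open import Data.Fin.Base using (Fin)
open import Data.List.Base using (List; []; _∷_)
open import Data.List.Membership.Propositional using (_∈_)
open import Data.Nat.Base using (ℕ)
open import Data.Product.Base using (∃-syntax; _×_)
open import Data.Sum.Base using (_⊎_)
open import Function.Bundles using (_↔_)
open import Level using (0ℓ)
open import Relation.Binary.Core using (Rel)
open import Relation.Binary.Definitions using (Transitive)
open import Relation.Binary.PropositionalEquality.Core using (_≡_)
open import Relation.Binary.Structures using (IsPartialOrder)
open import Relation.Unary using (Pred)

ℙ : Set
ℙ = ℕ

infixr 7 _∧_ _⟨∧⟩_
infixr 6 _∨_ _⟨∨⟩_
infixr 5 _⇒_ _⟨⇒⟩_
infix  8 ◇_ □_ ∼_

data 𝕃 : Set where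
  var         : ℙ → 𝕃
  ⊥′          : 𝕃
  _∧_ _∨_ _⇒_ : 𝕃 → 𝕃 → 𝕃
  ◇_ □_       : 𝕃 → 𝕃

∼_ : 𝕃 → 𝕃
∼ φ = φ ⇒ ⊥′

-- Formulas of intuitionistic propositional logic (no modalities).
data PropForm : Set where
  ⟨var⟩                   : ℙ → PropForm
  ⟨⊥⟩                     : PropForm
  _⟨∧⟩_ _⟨∨⟩_ _⟨⇒⟩_       : PropForm → PropForm → PropForm

-- Simultaneous substitution of modal formulas for propositional variables.
_[_] : PropForm → (ℙ → 𝕃) → 𝕃
⟨var⟩ p   [ σ ] = σ p
⟨⊥⟩       [ σ ] = ⊥′
(α ⟨∧⟩ β) [ σ ] = (α [ σ ]) ∧ (β [ σ ])
(α ⟨∨⟩ β) [ σ ] = (α [ σ ]) ∨ (β [ σ ])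
(α ⟨⇒⟩ β) [ σ ] = (α [ σ ]) ⇒ (β [ σ ])

-- Gentzen's natural deduction NJ; an intuitionistic tautology is a formula
-- derivable from no hypotheses.
infix 4 _⊢ᵢ_

data _⊢ᵢ_ (Γ : List PropForm) : PropForm → Set where
  hyp : ∀ {α} → α ∈ Γ → Γ ⊢ᵢ α
  ⊥E  : ∀ {α} → Γ ⊢ᵢ ⟨⊥⟩ → Γ ⊢ᵢ α
  ∧I  : ∀ {α β} → Γ ⊢ᵢ α → Γ ⊢ᵢ β → Γ ⊢ᵢ α ⟨∧⟩ β
  ∧E₁ : ∀ {α β} → Γ ⊢ᵢ α ⟨∧⟩ β → Γ ⊢ᵢ α
  ∧E₂ : ∀ {α β} → Γ ⊢ᵢ α ⟨∧⟩ β → Γ ⊢ᵢ β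
  ∨I₁ : ∀ {α β} → Γ ⊢ᵢ α → Γ ⊢ᵢ α ⟨∨⟩ β
  ∨I₂ : ∀ {α β} → Γ ⊢ᵢ β → Γ ⊢ᵢ α ⟨∨⟩ β
  ∨E  : ∀ {α β γ} → Γ ⊢ᵢ α ⟨∨⟩ β → α ∷ Γ ⊢ᵢ γ → β ∷ Γ ⊢ᵢ γ → Γ ⊢ᵢ γ
  ⇒I  : ∀ {α β} → α ∷ Γ ⊢ᵢ β → Γ ⊢ᵢ α ⟨⇒⟩ β
  ⇒E  : ∀ {α β} → Γ ⊢ᵢ α ⟨⇒⟩ β → Γ ⊢ᵢ α → Γ ⊢ᵢ β

Tautologyᵢ : PropForm → Set
Tautologyᵢ α = [] ⊢ᵢ α

-- The smallest set with the listed closure properties. In the modal axioms,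
-- φ and ψ range over all of 𝕃, so each is the set of substitution instances
-- of the axiom with distinct variables p, q in place of φ, ψ.
infix 4 IK4⊢_

data IK4⊢_ : 𝕃 → Set where
  taut   : ∀ {α} → Tautologyᵢ α → (σ : ℙ → 𝕃) → IK4⊢ α [ σ ]
  □K     : ∀ φ ψ → IK4⊢ □ (φ ⇒ ψ) ⇒ (□ φ ⇒ □ ψ)
  ◇K     : ∀ φ ψ → IK4⊢ □ (φ ⇒ ψ) ⇒ (◇ φ ⇒ ◇ ψ)
  ◇∨     : ∀ φ ψ → IK4⊢ ◇ (φ ∨ ψ) ⇒ (◇ φ ∨ ◇ ψ)
  ◇□     : ∀ φ ψ → IK4⊢ (◇ φ ⇒ □ ψ) ⇒ □ (φ ⇒ ψ)
  ◇⊥     : IK4⊢ ∼ ◇ ⊥′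
  ◇4     : ∀ φ → IK4⊢ ◇ ◇ φ ⇒ ◇ φ
  □4     : ∀ φ → IK4⊢ □ φ ⇒ □ □ φ
  mp     : ∀ {φ ψ} → IK4⊢ φ ⇒ ψ → IK4⊢ φ → IK4⊢ ψ
  nec    : ∀ {φ} → IK4⊢ φ → IK4⊢ □ φ

ForwardConfluent BackwardConfluent : {W : Set} → Rel W 0ℓ → Rel W 0ℓ → Set
ForwardConfluent _≼_ _⊏_ =
  ∀ {x y x′} → x ⊏ y → x ≼ x′ → ∃[ y′ ] (y ≼ y′ × x′ ⊏ y′)
BackwardConfluent _≼_ _⊏_ =
  ∀ {x y y′} → x ⊏ y → y ≼ y′ → ∃[ x′ ] (x ≼ x′ × x′ ⊏ y′)

record Model : Set₁ where
  infix 4 _≼_ _⊏_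
  field
    ∣_∣                : Set
    _≼_                : Rel ∣_∣ 0ℓ
    _⊏_                : Rel ∣_∣ 0ℓ
    ⟦_⟧                : ℙ → Pred ∣_∣ 0ℓ
    ≼-isPartialOrder   : IsPartialOrder _≡_ _≼_
    ⊏-transitive       : Transitive _⊏_
    forwardConfluent   : ForwardConfluent _≼_ _⊏_
    backwardConfluent  : BackwardConfluent _≼_ _⊏_
    persistent         : ∀ {p w v} → ⟦ p ⟧ w → w ≼ v → ⟦ p ⟧ v

open Model public using (∣_∣)

-- "Not φ at v, or ψ at v" is rendered in the implication clause by the function
-- space; the two are equivalent under excluded middle.
infix 4 _⊨_at_

_⊨_at_ : (M : Model) → 𝕃 → ∣ M ∣ → Set
M ⊨ var p at w   = Model.⟦_⟧ M p w
M ⊨ ⊥′ at w      = ⊥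
M ⊨ φ ∧ ψ at w   = M ⊨ φ at w × M ⊨ ψ at w
M ⊨ φ ∨ ψ at w   = M ⊨ φ at w ⊎ M ⊨ ψ at w
M ⊨ φ ⇒ ψ at w   = ∀ v → w ≼ v → M ⊨ φ at v → M ⊨ ψ at v
  where open Model M
M ⊨ ◇ φ at w     = ∃[ v ] (w ⊏ v × M ⊨ φ at v)
  where open Model M
M ⊨ □ φ at w     = ∀ u v → w ≼ u → u ⊏ v → M ⊨ φ at v
  where open Model M

Finite : Set → Set
Finite A = ∃[ n ] (A ↔ Fin n)

{-# OPTIONS --safe #-}
module Submission where

open import Defs
open import Axiom.ExcludedMiddle using (ExcludedMiddle)
open import Data.Product.Base using (Σ-syntax; _×_)
open import Relation.Nullary.Negation.Core using (¬_)

open import Data.Bool.Base using (Bool; true; false; T)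
open import Data.Empty using (⊥; ⊥-elim)
open import Data.Fin.Base using (Fin; zero; suc; toℕ)
open import Data.List.Base using (List; []; _∷_; _++_; map; filter; cartesianProductWith; allFin; length; lookup)
open import Data.List.Membership.Propositional using (_∈_)
open import Data.List.Membership.Propositional.Properties
  using (∈-++⁺ˡ; ∈-++⁺ʳ; ∈-cartesianProductWith⁺; ∈-map⁺; ∈-map⁻; ∈-allFin; ∈-filter⁺; ∈-filter⁻; ∈-lookup)
open import Data.List.Relation.Binary.Subset.Propositional using () renaming (_⊆_ to _⊆ₗ_)
open import Data.List.Relation.Unary.All as All using (All; []; _∷_)
open import Data.List.Relation.Unary.AllPairs as AllPairs using (AllPairs; []; _∷_)
import Data.List.Relation.Unary.AllPairs.Properties as AllPairsₚ
open import Data.List.Relation.Unary.Any using (Any; here; there; index)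
open import Data.List.Relation.Unary.All.Properties using (¬Any⇒All¬)
open import Data.List.Relation.Unary.Any.Properties using (lookup-index)
open import Data.Maybe.Base using (Maybe; just; nothing)
open import Data.Nat.Base using (ℕ; zero; suc; _≤_; _<_; _≤′_; _<′_; ≤′-reflexive; ≤′-step; _⊔_; z≤n; s≤s)
open import Data.Nat.Properties
  using (≤⇒≤′; ≤-refl; ≤-trans; m≤m⊔n; m≤n⊔m; <⇒≤; m≤n⇒m≤1+n; ≤-pred)
open import Data.Product.Base using (∃; ∃-syntax; _,_; proj₁; proj₂)
open import Data.Sum.Base as Sum using (_⊎_; inj₁; inj₂)
open import Data.Unit.Base using (⊤)
open import Function.Base using (id; _∘_)
open import Function.Construct.Identity using (↔-id)
open import Level using (0ℓ)
open import Relation.Binary.Construct.Closure.Transitive using (TransClosure; [_]; _∷_) renaming (_++_ to _++⁺_)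
open import Relation.Binary.Construct.Closure.ReflexiveTransitive using (Star; ε; _◅_; _◅◅_)
open import Relation.Binary.Core using (Rel)
import Relation.Binary.Construct.On as On
open import Relation.Binary.PropositionalEquality using (_≡_; refl; sym; trans; cong; subst; isEquivalence)
open import Relation.Binary.Structures using (IsEquivalence)
open import Relation.Nullary.Decidable.Core
  using (Dec; yes; no; ⌊_⌋; toWitness; fromWitness; decidable-stable)
open import Relation.Unary using (Pred; _⊆_; _∪_)

-- Unravel the canonical model into finite rooted trees of prime theories, each with
-- a distinguished vertex, and compare two such configurations by maps preserving the
-- strict descendant relation, the distinguished vertex and truth of subformulas of φ.
-- By Kruskal's theorem this is a well-quasi-order, so every configuration lies below
-- a decisive one (any two of whose extensions are compatible) and finitely many
-- decisive configurations are compatible with everything. These are the worlds of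
-- the finite model. The confluence conditions push a ≼-move of one vertex through a
-- whole tree, and this yields confluence of the finite model: decisiveness together
-- with the pigeonhole principle makes the choice of target uniform.

-- Derivations in IK4

private
  σ₃ : 𝕃 → 𝕃 → 𝕃 → ℙ → 𝕃
  σ₃ a b c 0 = a
  σ₃ a b c 1 = b
  σ₃ a b c _ = c

  A B C : PropForm
  A = ⟨var⟩ 0
  B = ⟨var⟩ 1
  C = ⟨var⟩ 2

ax-K : ∀ a b → IK4⊢ a ⇒ b ⇒ a
ax-K a b = taut {A ⟨⇒⟩ B ⟨⇒⟩ A} (⇒I (⇒I (hyp (there (here refl))))) (σ₃ a b b)

ax-S : ∀ a b c → IK4⊢ (a ⇒ b ⇒ c) ⇒ (a ⇒ b) ⇒ a ⇒ c
ax-S a b c = taut {(A ⟨⇒⟩ B ⟨⇒⟩ C) ⟨⇒⟩ (A ⟨⇒⟩ B) ⟨⇒⟩ A ⟨⇒⟩ C}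
  (⇒I (⇒I (⇒I (⇒E (⇒E (hyp (there (there (here refl)))) (hyp (here refl)))
                  (⇒E (hyp (there (here refl))) (hyp (here refl)))))))
  (σ₃ a b c)

ax-∧I : ∀ a b → IK4⊢ a ⇒ b ⇒ a ∧ b
ax-∧I a b = taut {A ⟨⇒⟩ B ⟨⇒⟩ A ⟨∧⟩ B}
  (⇒I (⇒I (∧I (hyp (there (here refl))) (hyp (here refl))))) (σ₃ a b b)

ax-∧E₁ : ∀ a b → IK4⊢ a ∧ b ⇒ a
ax-∧E₁ a b = taut {A ⟨∧⟩ B ⟨⇒⟩ A} (⇒I (∧E₁ (hyp (here refl)))) (σ₃ a b b)

ax-∧E₂ : ∀ a b → IK4⊢ a ∧ b ⇒ b
ax-∧E₂ a b = taut {A ⟨∧⟩ B ⟨⇒⟩ B} (⇒I (∧E₂ (hyp (here refl)))) (σ₃ a b b)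

ax-∨I₁ : ∀ a b → IK4⊢ a ⇒ a ∨ b
ax-∨I₁ a b = taut {A ⟨⇒⟩ A ⟨∨⟩ B} (⇒I (∨I₁ (hyp (here refl)))) (σ₃ a b b)

ax-∨I₂ : ∀ a b → IK4⊢ b ⇒ a ∨ b
ax-∨I₂ a b = taut {B ⟨⇒⟩ A ⟨∨⟩ B} (⇒I (∨I₂ (hyp (here refl)))) (σ₃ a b b)

ax-∨E : ∀ a b c → IK4⊢ (a ⇒ c) ⇒ (b ⇒ c) ⇒ a ∨ b ⇒ c
ax-∨E a b c = taut {(A ⟨⇒⟩ C) ⟨⇒⟩ (B ⟨⇒⟩ C) ⟨⇒⟩ A ⟨∨⟩ B ⟨⇒⟩ C}
  (⇒I (⇒I (⇒I (∨E (hyp (here refl))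
    (⇒E (hyp (there (there (there (here refl))))) (hyp (here refl)))
    (⇒E (hyp (there (there (here refl)))) (hyp (here refl)))))))
  (σ₃ a b c)

ax-⊥E : ∀ a → IK4⊢ ⊥′ ⇒ a
ax-⊥E a = taut {⟨⊥⟩ ⟨⇒⟩ A} (⇒I (⊥E (hyp (here refl)))) (σ₃ a a a)

Form : Set₁
Form = Pred 𝕃 0ℓ

∅′ : Form
∅′ _ = ⊥

infix 4 _⊢_
-- Necessitation enters only through `thm`, so it never applies to hypotheses; this is what makes
-- the deduction theorem `⇒-intro` hold.
data _⊢_ (Γ : Form) : 𝕃 → Set where
  ax  : ∀ {φ} → Γ φ → Γ ⊢ φ
  thm : ∀ {φ} → IK4⊢ φ → Γ ⊢ φ
  mp  : ∀ {φ ψ} → Γ ⊢ φ ⇒ ψ → Γ ⊢ φ → Γ ⊢ ψ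

_∙_ : ∀ {Γ φ ψ} → IK4⊢ φ ⇒ ψ → Γ ⊢ φ → Γ ⊢ ψ
f ∙ d = mp (thm f) d

cut : ∀ {Γ Δ φ} → (∀ {ψ} → Γ ψ → Δ ⊢ ψ) → Γ ⊢ φ → Δ ⊢ φ
cut s (ax i)   = s i
cut s (thm t)  = thm t
cut s (mp d e) = mp (cut s d) (cut s e)

weaken : ∀ {Γ Δ φ} → Γ ⊆ Δ → Γ ⊢ φ → Δ ⊢ φ
weaken s = cut (λ i → ax (s i))

∅⊢⇒IK4 : ∀ {φ} → ∅′ ⊢ φ → IK4⊢ φ
∅⊢⇒IK4 (thm t)  = t
∅⊢⇒IK4 (mp d e) = mp (∅⊢⇒IK4 d) (∅⊢⇒IK4 e)

infixl 5 _,,_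
_,,_ : Form → 𝕃 → Form
Γ ,, φ = Γ ∪ (φ ≡_)

⇒-intro : ∀ {Γ φ ψ} → Γ ,, φ ⊢ ψ → Γ ⊢ φ ⇒ ψ
⇒-intro (ax (inj₁ i))    = ax-K _ _ ∙ ax i
⇒-intro {φ = φ} (ax (inj₂ refl)) = mp (ax-S φ (φ ⇒ φ) φ ∙ thm (ax-K φ (φ ⇒ φ))) (thm (ax-K φ φ))
⇒-intro (thm t)          = ax-K _ _ ∙ thm t
⇒-intro (mp d e)         = mp (ax-S _ _ _ ∙ ⇒-intro d) (⇒-intro e)

⇒-elim : ∀ {Γ φ ψ} → Γ ⊢ φ ⇒ ψ → Γ ,, φ ⊢ ψ
⇒-elim d = mp (weaken inj₁ d) (ax (inj₂ refl))

∨-elim : ∀ {Γ a b c} → Γ ⊢ a ∨ b → Γ ,, a ⊢ c → Γ ,, b ⊢ c → Γ ⊢ c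
∨-elim d e f = mp (mp (ax-∨E _ _ _ ∙ ⇒-intro e) (⇒-intro f)) d

∧-intro : ∀ {Γ a b} → Γ ⊢ a → Γ ⊢ b → Γ ⊢ a ∧ b
∧-intro d e = mp (ax-∧I _ _ ∙ d) e

lift-□ : ∀ {a b} → IK4⊢ a ⇒ b → IK4⊢ □ a ⇒ □ b
lift-□ d = mp (□K _ _) (nec d)

lift-◇ : ∀ {a b} → IK4⊢ a ⇒ b → IK4⊢ ◇ a ⇒ ◇ b
lift-◇ d = mp (◇K _ _) (nec d)

theorem⇒ : ∀ {a b} → ∅′ ,, a ⊢ b → IK4⊢ a ⇒ b
theorem⇒ d = ∅⊢⇒IK4 (⇒-intro d)

□-∧ : ∀ {Γ a b} → Γ ⊢ □ a → Γ ⊢ □ b → Γ ⊢ □ (a ∧ b)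
□-∧ d e = mp (□K _ _ ∙ (lift-□ (ax-∧I _ _) ∙ d)) e

-- Directedness up to provable implication, weaker than closure under `∧`: it also covers the set of
-- all `◇ a` with `a` in a prime theory, where `◇ (a ∧ b)` is the lower bound.
record ∧-Closed (G : Form) : Set where
  field
    inhabited : ∃ G
    ∧-closed  : ∀ {a b} → G a → G b → ∃[ c ] (G c × (IK4⊢ c ⇒ a) × (IK4⊢ c ⇒ b))

compactness : ∀ {Γ G φ} → ∧-Closed G → Γ ∪ G ⊢ φ → ∃[ g ] (G g × Γ ⊢ g ⇒ φ)
compactness {Γ} {G} cl = go
  where
  open ∧-Closed cl
  some : ∀ {φ} → Γ ⊢ φ → ∃[ g ] (G g × Γ ⊢ g ⇒ φ)
  some d = proj₁ inhabited , proj₂ inhabited , ax-K _ _ ∙ d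
  go : ∀ {φ} → Γ ∪ G ⊢ φ → ∃[ g ] (G g × Γ ⊢ g ⇒ φ)
  go (ax (inj₁ i)) = some (ax i)
  go (ax (inj₂ i)) = _ , i , ⇒-intro (ax (inj₂ refl))
  go (thm t)       = some (thm t)
  go (mp d e) with go d | go e
  ... | a , Ga , da | b , Gb , db with ∧-closed Ga Gb
  ... | c , Gc , ca , cb = c , Gc , ⇒-intro
    (mp (mp (weaken inj₁ da) (ca ∙ ax (inj₂ refl))) (mp (weaken inj₁ db) (cb ∙ ax (inj₂ refl))))

subformulas : 𝕃 → List 𝕃
subformulas (var p)   = var p ∷ []
subformulas ⊥′        = ⊥′ ∷ []
subformulas φ@(a ∧ b) = φ ∷ subformulas a ++ subformulas b
subformulas φ@(a ∨ b) = φ ∷ subformulas a ++ subformulas b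
subformulas φ@(a ⇒ b) = φ ∷ subformulas a ++ subformulas b
subformulas φ@(◇ a)   = φ ∷ subformulas a
subformulas φ@(□ a)   = φ ∷ subformulas a

self∈ : ∀ φ → φ ∈ subformulas φ
self∈ (var p) = here refl
self∈ ⊥′      = here refl
self∈ (a ∧ b) = here refl
self∈ (a ∨ b) = here refl
self∈ (a ⇒ b) = here refl
self∈ (◇ a)   = here refl
self∈ (□ a)   = here refl

-- The canonical model

-- An increasing exhaustion of `𝕃` by finite lists takes the place of an enumeration; each
-- Lindenbaum stage treats a whole list.
formulas : ℕ → List 𝕃
formulas zero    = []
formulas (suc n) =
  var n ∷ ⊥′ ∷ l ++ map ◇_ l ++ map □_ l ++
  cartesianProductWith _∧_ l l ++ cartesianProductWith _∨_ l l ++ cartesianProductWith _⇒_ l l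
  where l = formulas n

formulas-mono′ : ∀ {m n φ} → m ≤′ n → φ ∈ formulas m → φ ∈ formulas n
formulas-mono′ (≤′-reflexive refl) i = i
formulas-mono′ (≤′-step p)         i = there (there (∈-++⁺ˡ (formulas-mono′ p i)))

formulas-mono : ∀ {m n φ} → m ≤ n → φ ∈ formulas m → φ ∈ formulas n
formulas-mono = formulas-mono′ ∘ ≤⇒≤′

formulas-joint : ∀ {a b m n} → a ∈ formulas m → b ∈ formulas n →
  a ∈ formulas (m ⊔ n) × b ∈ formulas (m ⊔ n)
formulas-joint {m = m} {n} i j = formulas-mono (m≤m⊔n m n) i , formulas-mono (m≤n⊔m m n) j

formulas-complete : ∀ φ → ∃[ n ] φ ∈ formulas n
formulas-complete (var p) = suc p , here refl
formulas-complete ⊥′      = 1 , there (here refl)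
formulas-complete (◇ a) with formulas-complete a
... | n , i = suc n , there (there (∈-++⁺ʳ (formulas n) (∈-++⁺ˡ (∈-map⁺ ◇_ i))))
formulas-complete (□ a) with formulas-complete a
... | n , i = suc n , there (there (∈-++⁺ʳ (formulas n)
  (∈-++⁺ʳ (map ◇_ (formulas n)) (∈-++⁺ˡ (∈-map⁺ □_ i)))))
formulas-complete (a ∧ b) with formulas-complete a | formulas-complete b
... | m , i | n , j = let l = formulas (m ⊔ n) ; i′ , j′ = formulas-joint i j in
  suc (m ⊔ n) , there (there (∈-++⁺ʳ l (∈-++⁺ʳ (map ◇_ l) (∈-++⁺ʳ (map □_ l)
    (∈-++⁺ˡ (∈-cartesianProductWith⁺ _∧_ i′ j′))))))
formulas-complete (a ∨ b) with formulas-complete a | formulas-complete b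
... | m , i | n , j = let l = formulas (m ⊔ n) ; i′ , j′ = formulas-joint i j in
  suc (m ⊔ n) , there (there (∈-++⁺ʳ l (∈-++⁺ʳ (map ◇_ l) (∈-++⁺ʳ (map □_ l)
    (∈-++⁺ʳ (cartesianProductWith _∧_ l l) (∈-++⁺ˡ (∈-cartesianProductWith⁺ _∨_ i′ j′)))))))
formulas-complete (a ⇒ b) with formulas-complete a | formulas-complete b
... | m , i | n , j = let l = formulas (m ⊔ n) ; i′ , j′ = formulas-joint i j in
  suc (m ⊔ n) , there (there (∈-++⁺ʳ l (∈-++⁺ʳ (map ◇_ l) (∈-++⁺ʳ (map □_ l)
    (∈-++⁺ʳ (cartesianProductWith _∧_ l l) (∈-++⁺ʳ (cartesianProductWith _∨_ l l)
      (∈-cartesianProductWith⁺ _⇒_ i′ j′)))))))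

-- A prime theory is kept as a Boolean function so that worlds live in Set.
record Prime : Set where
  no-eta-equality
  field
    mem : 𝕃 → Bool
  Mem : Form
  Mem φ = T (mem φ)
  field
    closed     : ∀ {φ} → Mem ⊢ φ → Mem φ
    consistent : ¬ Mem ⊥′
    prime      : ∀ {a b} → Mem (a ∨ b) → Mem a ⊎ Mem b

open Prime

infix 4 _∋_ _⊑_ _↝_
_∋_ : Prime → 𝕃 → Set
x ∋ φ = Mem x φ

-- Intuitionistically `□` and `◇` are not interdefinable, so the canonical accessibility relation
-- has a clause for each.
_⊑_ _↝_ : Prime → Prime → Set
x ⊑ y = ∀ {φ} → x ∋ φ → y ∋ φ
x ↝ y = (∀ {φ} → x ∋ □ φ → y ∋ φ) × (∀ {φ} → y ∋ φ → x ∋ ◇ φ)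

↝-trans : ∀ {x y z} → x ↝ y → y ↝ z → x ↝ z
↝-trans {x} {y} (b , d) (b′ , d′) =
  (λ i → b′ (b (closed x (□4 _ ∙ ax i)))) , (λ i → closed x (◇4 _ ∙ ax (d (d′ i))))

Mem-∧-Closed : ∀ x → ∧-Closed (Mem x)
Mem-∧-Closed x = record
  { inhabited = ⊥′ ⇒ ⊥′ , closed x (thm (ax-⊥E ⊥′))
  ; ∧-closed  = λ {a} {b} i j →
      a ∧ b , closed x (∧-intro (ax i) (ax j)) , ax-∧E₁ a b , ax-∧E₂ a b }

□⁻¹-∧-Closed : ∀ x → ∧-Closed (λ φ → x ∋ □ φ)
□⁻¹-∧-Closed x = record
  { inhabited = ⊥′ ⇒ ⊥′ , closed x (thm (nec (ax-⊥E ⊥′)))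
  ; ∧-closed  = λ {a} {b} i j →
      a ∧ b , closed x (□-∧ (ax i) (ax j)) , ax-∧E₁ a b , ax-∧E₂ a b }

module _ (em : ExcludedMiddle 0ℓ) where

  by-contradiction : {P : Set} → ¬ ¬ P → P
  by-contradiction = decidable-stable em

  -- Lindenbaum's lemma: prime theories avoiding a directed set

  module Lindenbaum
    (D : Form) (D-inhabited : ∃ D)
    (D-directed : ∀ {a b} → D a → D b → ∃[ c ] (D c × IK4⊢ a ∨ b ⇒ c)) where

    Avoids : Form → Set
    Avoids G = ∀ d → D d → ¬ (G ⊢ d)

    extend : Form → 𝕃 → Form
    extend G φ ψ = G ψ ⊎ (φ ≡ ψ × Avoids (G ,, φ))

    extends : Form → List 𝕃 → Form
    extends G []      = G
    extends G (φ ∷ l) = extends (extend G φ) l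

    extends-⊆ : ∀ {G} l → G ⊆ extends G l
    extends-⊆ []      i = i
    extends-⊆ (φ ∷ l) i = extends-⊆ l (inj₁ i)

    extend-avoids : ∀ {G} φ → Avoids G → Avoids (extend G φ)
    extend-avoids {G} φ av a Dd d with em {Avoids (G ,, φ)}
    ... | yes av′ = av′ a Dd (weaken (λ { (inj₁ i) → inj₁ i ; (inj₂ (e , _)) → inj₂ e }) d)
    ... | no ¬av′ = av a Dd (weaken (λ { (inj₁ i) → i ; (inj₂ (_ , c)) → ⊥-elim (¬av′ c) }) d)

    extends-avoids : ∀ {G} l → Avoids G → Avoids (extends G l)
    extends-avoids []      av = av
    extends-avoids (φ ∷ l) av = extends-avoids l (extend-avoids φ av)

    ,,-mono : ∀ {G H φ} → G ⊆ H → G ,, φ ⊆ H ,, φ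
    ,,-mono s (inj₁ i) = inj₁ (s i)
    ,,-mono s (inj₂ e) = inj₂ e

    extends-decides : ∀ {G φ} l → φ ∈ l → extends G l φ ⊎ ¬ Avoids (extends G l ,, φ)
    extends-decides (ψ ∷ l) (there i) = extends-decides l i
    extends-decides {G} {φ} (φ ∷ l) (here refl) with em {Avoids (G ,, φ)}
    ... | yes av = inj₁ (extends-⊆ l (inj₂ (refl , av)))
    ... | no ¬av = inj₂ λ av → ¬av λ a Dd d → av a Dd (weaken (,,-mono {H = extends (extend G φ) l} (λ i → extends-⊆ l (inj₁ i))) d)

    module _ {Γ : Form} (Γ-avoids : Avoids Γ) where

      stage : ℕ → Form
      stage zero    = Γ
      stage (suc n) = extends (stage n) (formulas n)

      stage-avoids : ∀ n → Avoids (stage n)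
      stage-avoids zero    = Γ-avoids
      stage-avoids (suc n) = extends-avoids (formulas n) (stage-avoids n)

      stage-mono′ : ∀ {m n} → m ≤′ n → stage m ⊆ stage n
      stage-mono′ (≤′-reflexive refl) i = i
      stage-mono′ (≤′-step {n} p)     i = extends-⊆ (formulas n) (stage-mono′ p i)

      Limit : Form
      Limit φ = ∃[ n ] stage n φ

      Limit⊢ : ∀ {φ} → Limit ⊢ φ → ∃[ n ] (stage n ⊢ φ)
      Limit⊢ (ax (n , i)) = n , ax i
      Limit⊢ (thm t)      = 0 , thm t
      Limit⊢ (mp d e) with Limit⊢ d | Limit⊢ e
      ... | m , d′ | n , e′ = m ⊔ n ,
        mp (weaken (stage-mono′ (≤⇒≤′ (m≤m⊔n m n))) d′) (weaken (stage-mono′ (≤⇒≤′ (m≤n⊔m m n))) e′)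

      Limit-avoids : Avoids Limit
      Limit-avoids a Dd d with Limit⊢ d
      ... | n , d′ = stage-avoids n a Dd d′

      Limit-decides : ∀ φ → Limit φ ⊎ (∃[ d ] (D d × Limit ,, φ ⊢ d))
      Limit-decides φ with formulas-complete φ
      ... | n , i with extends-decides {stage n} (formulas n) i
      ... | inj₁ j   = inj₁ (suc n , j)
      ... | inj₂ ¬av = inj₂ (by-contradiction λ no-d → ¬av λ d Dd e →
                         no-d (d , Dd , weaken (,,-mono {H = Limit} (λ i → suc n , i)) e))

      Limit-closed : ∀ {φ} → Limit ⊢ φ → Limit φ
      Limit-closed {φ} d with Limit-decides φ
      ... | inj₁ i             = i
      ... | inj₂ (_ , Dd , e) = ⊥-elim (Limit-avoids _ Dd (mp (⇒-intro e) d))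

      -- If neither disjunct were in the limit, each would derive a member of `D` when added; a
      -- common upper bound of the two would then follow from `a ∨ b`, which is in the limit.
      Limit-prime : ∀ {a b} → Limit (a ∨ b) → Limit a ⊎ Limit b
      Limit-prime {a} {b} i with Limit-decides a | Limit-decides b
      ... | inj₁ j | _      = inj₁ j
      ... | inj₂ _ | inj₁ j = inj₂ j
      ... | inj₂ (d , Dd , e) | inj₂ (d′ , Dd′ , e′) with D-directed Dd Dd′
      ... | c , Dc , t = ⊥-elim (Limit-avoids c Dc
        (∨-elim (ax i) (t ∙ (ax-∨I₁ d d′ ∙ e)) (t ∙ (ax-∨I₂ d d′ ∙ e′))))

      lindenbaum : Σ[ x ∈ Prime ] (Γ ⊆ Mem x × (∀ {d} → D d → ¬ x ∋ d))
      lindenbaum = x , (λ i → fromWitness (0 , i)) , λ Dd i → Limit-avoids _ Dd (ax (toWitness i))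
        where
        x : Prime
        x = record
          { mem        = λ φ → ⌊ em {Limit φ} ⌋
          ; closed     = λ d → fromWitness (Limit-closed (weaken toWitness d))
          ; consistent = λ i → Limit-avoids _ (proj₂ D-inhabited) (ax-⊥E _ ∙ ax (toWitness i))
          ; prime      = λ i → Sum.map fromWitness fromWitness (Limit-prime (toWitness i))
          }

  -- Existence lemmas for the canonical model

  prime-extension : ∀ {Γ ψ} → ¬ (Γ ⊢ ψ) → ∃[ x ] (Γ ⊆ Mem x × ¬ x ∋ ψ)
  prime-extension {Γ} {ψ} ⊬ψ =
    let x , ⊇ , om = lindenbaum {Γ} (λ d t e → ⊬ψ (t ∙ e))
    in x , ⊇ , om (theorem⇒ (ax (inj₂ refl)))
    where
    open Lindenbaum (λ d → IK4⊢ d ⇒ ψ) (⊥′ , ax-⊥E ψ)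
      (λ {a} {b} s t → a ∨ b , mp (mp (ax-∨E a b ψ) s) t , theorem⇒ (ax (inj₂ refl)))

  -- The formulas `d` with `◇ d` outside `x` are avoided; they are directed by `◇∨` and primality.
  -- If some `g` in `G` and some `b` with `□ b` in `x` derived such a `d`, then `◇K` would put
  -- `◇ g ⇒ ◇ d`, hence `◇ d`, into `x`.
  ◇-extension : ∀ x (G : Form) → ∧-Closed G → (∀ {φ} → G φ → x ∋ ◇ φ) →
    ∃[ y ] (G ⊆ Mem y × x ↝ y)
  ◇-extension x G cl G◇ =
    let y , ⊇ , om = lindenbaum {(λ φ → x ∋ □ φ) ∪ G} avoids
    in y , (λ i → ⊇ (inj₂ i)) , (λ i → ⊇ (inj₁ i)) , λ i → by-contradiction λ ni → om ni i
    where
    D : Form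
    D d = ¬ x ∋ ◇ d
    directed : ∀ {a b} → D a → D b → ∃[ c ] (D c × IK4⊢ a ∨ b ⇒ c)
    directed {a} {b} na nb = a ∨ b , (λ i → case (prime x (closed x (◇∨ a b ∙ ax i)))) ,
      theorem⇒ (ax (inj₂ refl))
      where
      case : (x ∋ ◇ a ⊎ x ∋ ◇ b) → ⊥
      case (inj₁ i) = na i
      case (inj₂ i) = nb i
    open Lindenbaum D (⊥′ , λ i → consistent x (closed x (◇⊥ ∙ ax i))) directed
    avoids : Avoids ((λ φ → x ∋ □ φ) ∪ G)
    avoids d nd e with compactness cl e
    ... | g , Gg , e′ with compactness (□⁻¹-∧-Closed x) (weaken {Δ = ∅′ ∪ _} inj₂ e′)
    ... | b , □b , e″ = nd (closed x (mp (◇K g d ∙ (lift-□ (∅⊢⇒IK4 e″) ∙ ax □b)) (ax (G◇ Gg))))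

  -- Every `◇ a` with `a` in `y` is added to `x`, and every `□ b` with `b` outside `y` is avoided.
  -- If `◇ a` led to `□ b` over `x`, the axiom `◇□` would put `□ (a ⇒ b)` into `x`, hence `a ⇒ b`
  -- and then `b` into `y`.
  □-extension : ∀ x y → (∀ {φ} → x ∋ □ φ → y ∋ φ) → ∃[ u ] (x ⊑ u × u ↝ y)
  □-extension x y x□y =
    let u , ⊇ , om = lindenbaum {Mem x ∪ G} avoids
    in u , (λ i → ⊇ (inj₁ i)) ,
       (λ {φ} i → by-contradiction λ ni → om (φ , ni , theorem⇒ (ax (inj₂ refl))) i) ,
       λ {φ} i → ⊇ (inj₂ (φ , i , theorem⇒ (ax (inj₂ refl))))
    where
    D G : Form
    D d = ∃[ b ] (¬ y ∋ b × IK4⊢ d ⇒ □ b)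
    G g = ∃[ a ] (y ∋ a × IK4⊢ ◇ a ⇒ g)
    G-closed : ∧-Closed (λ g → ∃[ a ] (y ∋ a × g ≡ ◇ a))
    G-closed = record
      { inhabited = ◇ (⊥′ ⇒ ⊥′) , _ , closed y (thm (ax-⊥E ⊥′)) , refl
      ; ∧-closed  = λ { (a , i , refl) (b , j , refl) →
          ◇ (a ∧ b) , (a ∧ b , closed y (∧-intro (ax i) (ax j)) , refl) ,
          lift-◇ (ax-∧E₁ a b) , lift-◇ (ax-∧E₂ a b) } }
    directed : ∀ {a b} → D a → D b → ∃[ c ] (D c × IK4⊢ a ∨ b ⇒ c)
    directed {a} {b} (a′ , na , s) (b′ , nb , t) = a ∨ b ,
      (a′ ∨ b′ , (λ i → Sum.[ na , nb ]′ (prime y i)) ,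
        mp (mp (ax-∨E a b _) (theorem⇒ (lift-□ (ax-∨I₁ a′ b′) ∙ (s ∙ ax (inj₂ refl)))))
          (theorem⇒ (lift-□ (ax-∨I₂ a′ b′) ∙ (t ∙ ax (inj₂ refl))))) ,
      theorem⇒ (ax (inj₂ refl))
    open Lindenbaum D (⊥′ , ⊥′ , consistent y , ax-⊥E _) directed
    avoids : Avoids (Mem x ∪ G)
    avoids d (b , nb , t) e
      with compactness {Γ = Mem x} G-closed (cut
        (λ { (inj₁ i) → ax (inj₁ i) ; (inj₂ (a , i , s)) → s ∙ ax (inj₂ (a , i , refl)) }) e)
    ... | _ , (a , i , refl) , e′ = nb (closed y (mp (ax (x□y (closed x
      (◇□ a b ∙ ⇒-intro (t ∙ ⇒-elim e′))))) (ax i)))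

  ↝-forward : ForwardConfluent _⊑_ _↝_
  ↝-forward {x} {y} {x′} (_ , d) x⊑x′ =
    ◇-extension x′ (Mem y) (Mem-∧-Closed y) (λ i → x⊑x′ (d i))

  ↝-backward : BackwardConfluent _⊑_ _↝_
  ↝-backward {x} {y} {y′} (b , _) y⊑y′ = □-extension x y′ (λ i → y⊑y′ (b i))

  ⇒-witness : ∀ {x a b} → ¬ x ∋ a ⇒ b → ∃[ y ] (x ⊑ y × y ∋ a × ¬ y ∋ b)
  ⇒-witness {x} ni with prime-extension (λ d → ni (closed x (⇒-intro d)))
  ... | y , ⊇ , om = y , (λ i → ⊇ (inj₁ i)) , ⊇ (inj₂ refl) , om

  ◇-witness : ∀ {x a} → x ∋ ◇ a → ∃[ y ] (x ↝ y × y ∋ a)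
  ◇-witness {x} {a} i =
    let y , ⊇ , xy = ◇-extension x (a ≡_) (record
          { inhabited = a , refl
          ; ∧-closed  = λ { refl refl →
              a , refl , theorem⇒ (ax (inj₂ refl)) , theorem⇒ (ax (inj₂ refl)) } })
          (λ { refl → i })
    in y , xy , ⊇ refl

  □-witness : ∀ {x a} → ¬ x ∋ □ a → ∃[ u ] ∃[ v ] (x ⊑ u × u ↝ v × ¬ v ∋ a)
  □-witness {x} {a} ni =
    let v , ⊇ , om = prime-extension {λ φ → x ∋ □ φ} ⊬a
        u , xu , uv = □-extension x v ⊇
    in u , v , xu , uv , om
    where
    ⊬a : ¬ ((λ φ → x ∋ □ φ) ⊢ a)
    ⊬a d with compactness {Γ = ∅′} (□⁻¹-∧-Closed x) (weaken inj₂ d)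
    ... | b , i , e = ni (closed x (lift-□ (∅⊢⇒IK4 e) ∙ ax i))

  -- Kruskal's theorem

  Inf : Pred ℕ 0ℓ → Set
  Inf P = ∀ n → ∃[ m ] (n ≤ m × P m)

  -- Either the first colour occurs infinitely often, or beyond some bound it no longer occurs and
  -- the remaining colours suffice there.
  pigeonhole : ∀ {C : Set} (l : List C) (B : C → ℕ → Set) {P} → Inf P →
    (∀ {m} → P m → ∃[ c ] (c ∈ l × B c m)) → ∃[ c ] (c ∈ l × Inf (λ m → P m × B c m))
  pigeonhole [] B inf f with f (proj₂ (proj₂ (inf 0)))
  ... | _ , () , _
  pigeonhole (c ∷ l) B {P} inf f with em {Inf (λ m → P m × B c m)}
  ... | yes inf-c = c , here refl , inf-c
  ... | no ¬inf-c =
    let n , none = by-contradiction {∃[ n ] (∀ {m} → n ≤ m → P m → ¬ B c m)}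
          (λ h → ¬inf-c λ n → by-contradiction λ h′ → h (n , λ {m} n≤m p b → h′ (m , n≤m , p , b)))
        d , i , inf′ = pigeonhole l B {λ m → P m × n ≤ m}
          (λ k → let m , k⊔n≤m , p = inf (k ⊔ n)
                 in m , ≤-trans (m≤m⊔n k n) k⊔n≤m , p , ≤-trans (m≤n⊔m k n) k⊔n≤m)
          (λ (p , n≤m) → other (none n≤m p) (f p))
    in d , there i , λ k → let m , k≤m , (p , _) , b = inf′ k in m , k≤m , p , b
    where
    other : ∀ {m} → ¬ B c m → ∃[ c′ ] (c′ ∈ c ∷ l × B c′ m) → ∃[ c′ ] (c′ ∈ l × B c′ m)
    other ¬b (_ , here refl , b) = ⊥-elim (¬b b)
    other ¬b (c′ , there i , b)  = c′ , i , b

  -- Lists grow at the head, so the pairs of a bad list are read from right to left.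
  Bad : {X : Set} → Rel X 0ℓ → List X → Set
  Bad _≲_ = AllPairs (λ y x → ¬ x ≲ y)

  -- Bar R [] is the inductive form of "every infinite sequence has a good pair".
  data Bar {X : Set} (R : Rel X 0ℓ) (xs : List X) : Set where
    now   : ¬ Bad R xs → Bar R xs
    later : (∀ x → Bar R (x ∷ xs)) → Bar R xs

  module Kruskal {X : Set} (size : X → ℕ) (children : X → List X)
    (children-size : ∀ {x c} → c ∈ children x → size c < size x)
    (_~_ : Rel X 0ℓ)
    (homogeneous : ∀ (s : ℕ → X) →
      Σ[ Q ∈ Pred ℕ 0ℓ ] (Inf Q × (∀ {i j} → Q i → Q j → s i ~ s j))) where

    infix 4 _≲_
    -- Distinct children may share an image, as tree homomorphisms need not be injective. The
    -- pigeonhole principle on children can therefore do the work of Higman's lemma in the proof of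
    -- Kruskal's theorem.
    data _≲_ (x y : X) : Set where
      root  : x ~ y → (∀ {c} → c ∈ children x → ∃[ d ] (d ∈ children y × c ≲ d)) → x ≲ y
      below : ∀ {d} → d ∈ children y → x ≲ d → x ≲ y

    least : (P : X → Set) → ∀ n {x} → size x ≤ n → P x →
      ∃[ y ] (P y × (∀ {z} → size z < size y → ¬ P z))
    least P n {x} x≤n p with em {∃[ z ] (size z < size x × P z)}
    ... | no h = x , p , λ {z} z<x q → h (z , z<x , q)
    least P zero    x≤n p | yes (z , z<x , q) with ≤-trans z<x x≤n
    ... | ()
    least P (suc n) x≤n p | yes (z , z<x , q) = least P n (≤-pred (≤-trans z<x x≤n)) q

    module MinimalBad (¬bar : ¬ Bar _≲_ []) where

      -- The choice behind Nash-Williams' minimal bad sequence, with failure of `Bar` standing for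
      -- the existence of an infinite bad continuation.
      next : ∀ {xs} → ¬ Bar _≲_ xs →
        ∃[ x ] (¬ Bar _≲_ (x ∷ xs) × (∀ {y} → size y < size x → Bar _≲_ (y ∷ xs)))
      next {xs} h with by-contradiction {∃[ x ] ¬ Bar _≲_ (x ∷ xs)}
                         (λ g → h (later λ x → by-contradiction λ b → g (x , b)))
      ... | x , b with least (λ x → ¬ Bar _≲_ (x ∷ xs)) (size x) ≤-refl b
      ... | y , c , m = y , c , λ z<y → by-contradiction (m z<y)

      state : ℕ → Σ[ xs ∈ List X ] ¬ Bar _≲_ xs
      state zero    = [] , ¬bar
      state (suc n) = let xs , h = state n ; x , h′ , _ = next h in x ∷ xs , h′

      prefix : ℕ → List X
      prefix n = proj₁ (state n)

      f : ℕ → X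
      f n = proj₁ (next (proj₂ (state n)))

      f-minimal : ∀ n {y} → size y < size (f n) → Bar _≲_ (y ∷ prefix n)
      f-minimal n = proj₂ (proj₂ (next (proj₂ (state n))))

      prefix-All : ∀ {P : X → Set} n → (∀ {i} → i < n → P (f i)) → All P (prefix n)
      prefix-All zero    h = []
      prefix-All (suc n) h = h ≤-refl ∷ prefix-All n (λ i<n → h (m≤n⇒m≤1+n i<n))

      ∈-prefix : ∀ {i n} → i <′ n → f i ∈ prefix n
      ∈-prefix (≤′-reflexive refl) = here refl
      ∈-prefix (≤′-step p)         = there (∈-prefix p)

      prefix-bad : ∀ n → Bad _≲_ (prefix n)
      prefix-bad n = by-contradiction λ h → proj₂ (state n) (now h)

      f-bad : ∀ {i j} → i < j → ¬ f i ≲ f j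
      f-bad {i} {j} i<j = All.lookup (AllPairs.head (prefix-bad (suc j))) (∈-prefix (≤⇒≤′ i<j))

      Q₀ : Pred ℕ 0ℓ
      Q₀ = proj₁ (homogeneous f)

      record Stage : Set₁ where
        field
          Q       : Pred ℕ 0ℓ
          Q-inf   : Inf Q
          Q⊆Q₀    : Q ⊆ Q₀

        position : ℕ
        position = proj₁ (Q-inf 0)

        position∈ : Q position
        position∈ = proj₂ (proj₂ (Q-inf 0))

        Unmatched : X → ℕ → Set
        Unmatched c j = ∀ {d} → d ∈ children (f j) → ¬ c ≲ d

        -- For later `j` in `Q` the roots are related but `f position ≲ f j` fails, so some child of
        -- `f position` has no match among the children of `f j`; one such child serves infinitely
        -- many `j`.
        refine : ∃[ c ] (c ∈ children (f position) ×
                         Inf (λ j → (Q j × position < j) × Unmatched c j))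
        refine = pigeonhole (children (f position)) Unmatched
          (λ n → let m , le , q = Q-inf (n ⊔ suc position) in
             m , ≤-trans (m≤m⊔n n _) le , q , ≤-trans (m≤n⊔m n _) le)
          λ { {j} (q , p<j) → by-contradiction λ h → f-bad p<j
            (root (proj₂ (proj₂ (homogeneous f)) (Q⊆Q₀ position∈) (Q⊆Q₀ q))
              λ {c} i → by-contradiction λ no-d → h (c , i , λ {d} k c≲d → no-d (d , k , c≲d))) }

      open Stage

      refined : Stage → Stage
      refined s = record
        { Q     = λ j → (Q s j × position s < j) × Unmatched s (proj₁ (refine s)) j
        ; Q-inf = proj₂ (proj₂ (refine s))
        ; Q⊆Q₀  = λ ((q , _) , _) → Q⊆Q₀ s q
        }

      stage : ℕ → Stage
      stage zero    = record { Q = Q₀ ; Q-inf = proj₁ (proj₂ (homogeneous f)) ; Q⊆Q₀ = λ q → q }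
      stage (suc k) = refined (stage k)

      stage-⊆ : ∀ {k l} → k ≤′ l → Q (stage l) ⊆ Q (stage k)
      stage-⊆ (≤′-reflexive refl) q             = q
      stage-⊆ (≤′-step k≤l)       ((q , _) , _) = stage-⊆ k≤l q

      pos : ℕ → ℕ
      pos k = position (stage k)

      child : ℕ → X
      child k = proj₁ (refine (stage k))

      child∈ : ∀ k → child k ∈ children (f (pos k))
      child∈ k = proj₁ (proj₂ (refine (stage k)))

      child-bad : ∀ {k l} → k < l → ¬ child k ≲ child l
      child-bad {k} {l} k<l =
        proj₂ (stage-⊆ (≤⇒≤′ k<l) (position∈ (stage l))) (child∈ l)

      pos-mono : ∀ k → pos 0 ≤ pos k
      pos-mono zero    = ≤-refl
      pos-mono (suc k) = <⇒≤ (proj₂ (proj₁ (stage-⊆ {1} {suc k} (≤⇒≤′ (s≤s z≤n)) (position∈ (stage (suc k))))))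

      -- The minimal sequence is cut before `pos 0` and continued by the chosen children. The result
      -- stays bad forever, yet its first child is smaller than `f (pos 0)`, against minimality.
      spliced : ℕ → List X
      spliced zero    = child 0 ∷ prefix (pos 0)
      spliced (suc k) = child (suc k) ∷ spliced k

      splice-All : ∀ {P : X → Set} k → (∀ {i} → i < pos 0 → P (f i)) → (∀ {l} → l ≤ k → P (child l)) →
        All P (spliced k)
      splice-All zero    h h′ = h′ z≤n ∷ prefix-All (pos 0) h
      splice-All (suc k) h h′ = h′ ≤-refl ∷ splice-All k h (λ l≤k → h′ (m≤n⇒m≤1+n l≤k))

      f≴child : ∀ k {i} → i < pos 0 → ¬ f i ≲ child k
      f≴child k i<p r = f-bad (≤-trans i<p (pos-mono k)) (below (child∈ k) r)

      spliced-bad : ∀ k → Bad _≲_ (spliced k)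
      spliced-bad zero    = prefix-All (pos 0) (f≴child 0) ∷ prefix-bad (pos 0)
      spliced-bad (suc k) =
        splice-All k (f≴child (suc k)) (λ l≤k → child-bad (s≤s l≤k)) ∷ spliced-bad k

      -- By recursion on the bar: fed with successive children it would unfold to some `now`, which
      -- badness excludes.
      spliced-unbarred : ∀ k → ¬ Bar _≲_ (spliced k)
      spliced-unbarred k (now h)   = h (spliced-bad k)
      spliced-unbarred k (later h) = spliced-unbarred (suc k) (h (child (suc k)))

      absurd : ⊥
      absurd = spliced-unbarred 0 (f-minimal (pos 0) (children-size (child∈ 0)))

    kruskal : Bar _≲_ []
    kruskal = by-contradiction MinimalBad.absurd

  -- For each predicate in turn, the index set shrinks to an infinite half on which that predicate
  -- is constant.
  homogeneous-subset : ∀ {C : Set} (l : List C) (P : C → ℕ → Set) →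
    Σ[ Q ∈ Pred ℕ 0ℓ ] (Inf Q × (∀ {c i j} → c ∈ l → Q i → Q j → P c i → P c j))
  homogeneous-subset [] P = (λ _ → ⊤) , (λ n → n , ≤-refl , _) , λ ()
  homogeneous-subset (c ∷ l) P with homogeneous-subset l P
  ... | Q , inf , hom with pigeonhole (true ∷ false ∷ []) Side {Q} inf (λ _ → side)
    where
    Side : Bool → ℕ → Set
    Side true  i = P c i
    Side false i = ¬ P c i
    side : ∀ {i} → ∃[ b ] (b ∈ true ∷ false ∷ [] × Side b i)
    side {i} with em {P c i}
    ... | yes p = true , here refl , p
    ... | no np = false , there (here refl) , np
  ... | true , _ , inf′ = _ , inf′ , λ
    { (here refl) _ (_ , p) _ → p
    ; (there k) (q , _) (q′ , _) → hom k q q′ }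
  ... | false , _ , inf′ = _ , inf′ , λ
    { (here refl) (_ , np) _ p → ⊥-elim (np p)
    ; (there k) (q , _) (q′ , _) → hom k q q′ }

  Bar-comap : ∀ {X Y : Set} {R : Rel X 0ℓ} {R′ : Rel Y 0ℓ} (g : X → Y) →
    (∀ {x y} → R′ (g x) (g y) → R x y) → ∀ {xs} → Bar R′ (map g xs) → Bar R xs
  Bar-comap g refl-R (now h) =
    now λ bad → h (AllPairsₚ.map⁺ (AllPairs.map (λ ¬r r′ → ¬r (refl-R r′)) bad))
  Bar-comap g refl-R (later h) = later λ x → Bar-comap g refl-R (h (g x))

  -- Representatives replace equivalence classes, so the quotient again has a carrier `Fin m` and
  -- its order is antisymmetric up to `≡`.
  transversal : ∀ {n} {_≃_ : Rel (Fin n) 0ℓ} → IsEquivalence _≃_ →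
    ∃[ m ] Σ[ e ∈ (Fin m → Fin n) ] ((∀ i → ∃[ k ] i ≃ e k) × (∀ {k l} → e k ≃ e l → k ≡ l))
  transversal {zero} _ = 0 , (λ ()) , (λ ()) , λ {}
  transversal {suc n} {_≃_} eqv =
    let m , e , cov , inj = transversal (On.isEquivalence suc eqv) in add m e cov inj em
    where
    open IsEquivalence eqv renaming (refl to ≃-refl; sym to ≃-sym)
    Result : Set
    Result = ∃[ m ] Σ[ e ∈ (Fin m → Fin (suc n)) ]
      ((∀ i → ∃[ k ] i ≃ e k) × (∀ {k l} → e k ≃ e l → k ≡ l))
    add : ∀ m (e : Fin m → Fin n) → (∀ i → ∃[ k ] suc i ≃ suc (e k)) →
      (∀ {k l} → suc (e k) ≃ suc (e l) → k ≡ l) → Dec (∃[ k ] zero ≃ suc (e k)) → Result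
    add m e cov inj (yes z) = m , suc ∘ e , (λ { zero → z ; (suc i) → cov i }) , inj
    add m e cov inj (no nz) = suc m , e′ ,
      (λ { zero → zero , ≃-refl ; (suc i) → suc (proj₁ (cov i)) , proj₂ (cov i) }) ,
      λ {k} {l} → e′-injective k l
      where
      e′ : Fin (suc m) → Fin (suc n)
      e′ zero    = zero
      e′ (suc k) = suc (e k)
      e′-injective : ∀ k l → e′ k ≃ e′ l → k ≡ l
      e′-injective zero    zero    _ = refl
      e′-injective zero    (suc l) r = ⊥-elim (nz (l , r))
      e′-injective (suc k) zero    r = ⊥-elim (nz (k , ≃-sym r))
      e′-injective (suc k) (suc l) r = cong suc (inj r)

  -- Finite trees of worlds, rooted at the vertex of largest index

  -- A grafted leaf takes index `zero` and shifts the others up. Indices thus decrease along edges,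
  -- which supplies the size for Kruskal's theorem, and induction on the shape adds one edge at a
  -- time.
  data Shape : ℕ → Set where
    leaf  : Shape 1
    graft : ∀ {n} → Shape n → Fin n → Shape (suc n)

  data Edge : ∀ {n} → Shape n → Rel (Fin n) 0ℓ where
    new : ∀ {n} {S : Shape n} {p} → Edge (graft S p) (suc p) zero
    old : ∀ {n} {S : Shape n} {p i j} → Edge S i j → Edge (graft S p) (suc i) (suc j)

  top : ∀ {n} → Shape n → Fin n
  top leaf        = zero
  top (graft S _) = suc (top S)

  Edge-< : ∀ {n} {S : Shape n} {i j} → Edge S i j → toℕ j < toℕ i
  Edge-< new     = s≤s z≤n
  Edge-< (old e) = s≤s (Edge-< e)

  Below : ∀ {n} → Shape n → Rel (Fin n) 0ℓ
  Below S = TransClosure (Edge S)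

  record Tree : Set where
    no-eta-equality
    field
      {order} : ℕ
      shape   : Shape order
      world   : Fin order → Prime
      edge    : ∀ {i j} → Edge shape i j → world i ↝ world j

  open Tree

  Below-↝ : ∀ T {i j} → Below (shape T) i j → world T i ↝ world T j
  Below-↝ T [ e ]   = edge T e
  Below-↝ T {i} {j} (_∷_ {y = k} e b) = ↝-trans {world T i} {world T k} {world T j} (edge T e) (Below-↝ T b)

  singleton : Prime → Tree
  singleton x = record { shape = leaf ; world = λ _ → x ; edge = λ () }

  grow : ∀ T i {y} → world T i ↝ y → Tree
  grow T i {y} r = record { shape = graft (shape T) i ; world = w ; edge = e }
    where
    w : Fin (suc (order T)) → Prime
    w zero    = y
    w (suc j) = world T j
    e : ∀ {i′ j} → Edge (graft (shape T) i) i′ j → w i′ ↝ w j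
    e new     = r
    e (old e) = edge T e

  record Move {n} (S : Shape n) (w : Fin n → Prime) : Set where
    field
      target : Fin n → Prime
      valid  : ∀ {i j} → Edge S i j → target i ↝ target j
      raises : ∀ i → w i ⊑ target i

  open Move

  -- Both confluence conditions together propagate a move of one vertex along all
  -- edges of a tree.
  move-at : ∀ {n} (S : Shape n) (w : Fin n → Prime) → (∀ {i j} → Edge S i j → w i ↝ w j) →
    ∀ i {u} → w i ⊑ u → Σ[ m ∈ Move S w ] target m i ≡ u
  move-at leaf w e zero {u} r = record
    { target = λ _ → u ; valid = λ () ; raises = λ { zero → r } } , refl
  -- The new leaf itself moves: backward confluence raises its parent, and the recursion carries
  -- that move to the rest of the tree.
  move-at (graft S p) w e zero {u} r with ↝-backward {w (suc p)} {w zero} {u} (e new) r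
  ... | p′ , wp⊑p′ , p′↝u with move-at S (w ∘ suc) (e ∘ old) p {p′} wp⊑p′
  ... | m , refl = record
    { target = λ { zero → u ; (suc j) → target m j }
    ; valid  = λ { new → p′↝u ; (old d) → valid m d }
    ; raises = λ { zero → r ; (suc j) → raises m j } } , refl
  -- An old vertex moves: the new leaf follows its parent by forward confluence.
  move-at (graft S p) w e (suc i) {u} r with move-at S (w ∘ suc) (e ∘ old) i {u} r
  ... | m , eq with ↝-forward {w (suc p)} {w zero} {target m p} (e new) (raises m p)
  ... | y , w0⊑y , p↝y = record
    { target = λ { zero → y ; (suc j) → target m j }
    ; valid  = λ { new → p↝y ; (old d) → valid m d }
    ; raises = λ { zero → w0⊑y ; (suc j) → raises m j } } , eq

  moved : ∀ T → Move (shape T) (world T) → Tree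
  moved T m = record { shape = shape T ; world = target m ; edge = valid m }

  -- Homomorphisms of labelled trees and their well-quasi-order

  module Labelled (Φ : List 𝕃) where

    infix 4 _≈_ _⊴_ _&_

    _≈_ : Prime → Prime → Set
    x ≈ y = ∀ {φ} → φ ∈ Φ → (x ∋ φ → y ∋ φ) × (y ∋ φ → x ∋ φ)

    ≈-trans : ∀ {x y z} → x ≈ y → y ≈ z → x ≈ z
    ≈-trans p q i = proj₁ (q i) ∘ proj₁ (p i) , proj₂ (p i) ∘ proj₂ (q i)

    -- Edges may be stretched to paths, matching the clause `below` of the tree embedding; since `↝`
    -- is transitive, paths still carry `↝`.
    record Hom (T T′ : Tree) : Set where
      no-eta-equality
      field
        vertex   : Fin (order T) → Fin (order T′)
        vertex-≈ : ∀ i → world T i ≈ world T′ (vertex i)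
        vertex-< : ∀ {i j} → Edge (shape T) i j → Below (shape T′) (vertex i) (vertex j)

    open Hom

    Hom-Below : ∀ {T T′} (f : Hom T T′) {i j} →
      Below (shape T) i j → Below (shape T′) (vertex f i) (vertex f j)
    Hom-Below f [ e ]   = vertex-< f e
    Hom-Below f (e ∷ b) = vertex-< f e ++⁺ Hom-Below f b

    idʰ : ∀ {T} → Hom T T
    idʰ = record { vertex = id ; vertex-≈ = λ _ _ → id , id ; vertex-< = [_] }

    infixr 9 _∘ʰ_
    _∘ʰ_ : ∀ {T T′ T″} → Hom T′ T″ → Hom T T′ → Hom T T″
    _∘ʰ_ {T} {T′} {T″} g f = record
      { vertex   = vertex g ∘ vertex f
      ; vertex-≈ = λ i → ≈-trans {world T i} {world T′ (vertex f i)} {world T″ _}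
                     (vertex-≈ f i) (vertex-≈ g (vertex f i))
      ; vertex-< = λ e → Hom-Below g (vertex-< f e)
      }

    grow-Hom : ∀ T i {y} (r : world T i ↝ y) → Hom T (grow T i {y} r)
    grow-Hom T i r = record
      { vertex = suc ; vertex-≈ = λ _ _ → id , id ; vertex-< = λ e → [ old e ] }

    Conf : Set
    Conf = Σ[ T ∈ Tree ] Fin (order T)

    at : Conf → Prime
    at (T , t) = world T t

    record _⊴_ (p q : Conf) : Set where
      no-eta-equality
      pattern
      constructor _&_
      field
        hom   : Hom (proj₁ p) (proj₁ q)
        point : vertex hom (proj₂ p) ≡ proj₂ q

    open _⊴_

    ⊴-refl : ∀ {p} → p ⊴ p
    ⊴-refl = idʰ & refl

    ⊴-trans : ∀ {p q r} → p ⊴ q → q ⊴ r → p ⊴ r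
    ⊴-trans (f & eq) (g & eq′) = g ∘ʰ f & trans (cong (vertex g) eq) eq′

    ⊴-≈ : ∀ {p q} → p ⊴ q → at p ≈ at q
    ⊴-≈ {T , t} (f & refl) = vertex-≈ f t

    -- A configuration together with a vertex whose subtree is under consideration.
    Marked : Set
    Marked = Σ[ p ∈ Conf ] Fin (order (proj₁ p))

    children : Marked → List Marked
    children (p@(T , _) , v) = map (p ,_) (filter (λ c → em {Edge (shape T) v c}) (allFin _))

    children⁺ : ∀ {p} {v c} → Edge (shape (proj₁ p)) v c → (p , c) ∈ children (p , v)
    children⁺ e = ∈-map⁺ _ (∈-filter⁺ _ (∈-allFin _) e)

    children⁻ : ∀ {p v x} → x ∈ children (p , v) → ∃[ c ] (x ≡ (p , c) × Edge (shape (proj₁ p)) v c)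
    children⁻ {p} i with ∈-map⁻ (p ,_) i
    ... | c , j , eq = c , eq , proj₂ (∈-filter⁻ _ {xs = allFin _} j)

    children-size : ∀ {x c} → c ∈ children x → toℕ (proj₂ c) < toℕ (proj₂ x)
    children-size i with children⁻ i
    ... | _ , refl , e = Edge-< e

    -- The second component makes homomorphisms obtained from `≲` preserve the distinguished vertex.
    _~_ : Rel Marked 0ℓ
    ((T , t) , v) ~ ((T′ , t′) , v′) = world T v ≈ world T′ v′ × (v ≡ t → v′ ≡ t′)

    homogeneous : ∀ (s : ℕ → Marked) →
      Σ[ Q ∈ Pred ℕ 0ℓ ] (Inf Q × (∀ {i j} → Q i → Q j → s i ~ s j))
    homogeneous s with homogeneous-subset (nothing ∷ map just Φ) P
      where
      P : Maybe 𝕃 → ℕ → Set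
      -- `nothing` codes the property of being the distinguished vertex, `just φ` the truth of `φ`.
      P nothing  i = proj₂ (s i) ≡ proj₂ (proj₁ (s i))
      P (just φ) i = at (proj₁ (proj₁ (s i)) , proj₂ (s i)) ∋ φ
    ... | Q , inf , hom = Q , inf , λ q q′ →
      (λ φ∈ → hom (there (∈-map⁺ just φ∈)) q q′ , hom (there (∈-map⁺ just φ∈)) q′ q) ,
      hom (here refl) q q′

    open Kruskal (toℕ ∘ proj₂) children children-size _~_ homogeneous

    Match : Rel Marked 0ℓ
    Match x y = x ~ y × (∀ {c} → c ∈ children x → ∃[ d ] (d ∈ children y × c ≲ d))

    match-below : ∀ {x q u v} → Edge (shape (proj₁ q)) u v → x ≲ (q , v) →
      ∃[ w ] (Below (shape (proj₁ q)) u w × Match x (q , w))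
    match-below e (root x~y m) = _ , [ e ] , x~y , m
    match-below e (below i r) with children⁻ i
    ... | c , refl , e′ with match-below e′ r
    ... | w , b , m = w , e ∷ b , m

    match : ∀ {x q v} → x ≲ (q , v) → ∃[ w ] Match x (q , w)
    match (root x~y m) = _ , x~y , m
    match (below i r) with children⁻ i
    ... | _ , refl , e with match-below e r
    ... | w , _ , m = w , m

    -- Each vertex is sent to one that also matches its children, so whenever a leaf is grafted the
    -- image of its parent offers a place for it further down.
    match-shape : ∀ {p q n} (S : Shape n) (ι : Fin n → Fin (order (proj₁ p))) →
      (∀ {i j} → Edge S i j → Edge (shape (proj₁ p)) (ι i) (ι j)) →
      ∃[ w ] Match (p , ι (top S)) (q , w) →
      Σ[ g ∈ (Fin n → Fin (order (proj₁ q))) ]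
        ((∀ i → Match (p , ι i) (q , g i)) × (∀ {i j} → Edge S i j → Below (shape (proj₁ q)) (g i) (g j)))
    match-shape leaf ι ι-edge (w , m) = (λ _ → w) , (λ { zero → m }) , λ ()
    match-shape {p} {q} (graft S i₀) ι ι-edge m with match-shape {p} {q} S (ι ∘ suc) (ι-edge ∘ old) m
    ... | g , gm , g< with proj₂ (gm i₀) (children⁺ (ι-edge new))
    ... | d , d∈ , r with children⁻ d∈
    ... | _ , refl , e with match-below e r
    ... | w , b , m₀ =
      (λ { zero → w ; (suc j) → g j }) , (λ { zero → m₀ ; (suc j) → gm j }) ,
      λ { new → b ; (old e) → g< e }

    rooted : Conf → Marked
    rooted p = p , top (shape (proj₁ p))

    ≲⇒⊴ : ∀ {p q} → rooted p ≲ rooted q → p ⊴ q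
    ≲⇒⊴ {p} {q} r with match-shape {p} {q} (shape (proj₁ p)) id id (match r)
    ... | g , gm , g< =
      record { vertex = g ; vertex-≈ = proj₁ ∘ proj₁ ∘ gm ; vertex-< = g< } & proj₂ (proj₁ (gm _)) refl

    abstract
      ⊴-bar : Bar _⊴_ []
      ⊴-bar = Bar-comap rooted ≲⇒⊴ kruskal

    -- Decisive configurations and the finite frame they form

    Compatible : Rel Conf 0ℓ
    Compatible p q = ∃[ r ] (p ⊴ r × q ⊴ r)

    Decisive : Conf → Set
    Decisive s = ∀ p q → s ⊴ p → s ⊴ q → Compatible p q

    -- Otherwise repeated splitting above p would leave an infinite family of
    -- pairwise incompatible configurations.
    decisive-above : ∀ p → ∃[ s ] (p ⊴ s × Decisive s)
    decisive-above p = go ⊴-bar [] p [] ⊴-refl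
      where
      go : ∀ {xs} → Bar _⊴_ xs → Bad _⊴_ xs → ∀ c → All (λ d → ¬ Compatible d c) xs → p ⊴ c →
        ∃[ s ] (p ⊴ s × Decisive s)
      go (now h) bad = ⊥-elim (h bad)
      go (later h) bad c inc p⊴c with em {Decisive c}
      ... | yes dec = c , p⊴c , dec
      ... | no ¬dec with by-contradiction {∃[ q₁ ] ∃[ q₂ ] (c ⊴ q₁ × c ⊴ q₂ × ¬ Compatible q₁ q₂)}
                           (λ h′ → ¬dec λ _ _ s t → by-contradiction λ ¬com → h′ (_ , _ , s , t , ¬com))
      -- `q₁` joins the list and the search continues from `q₂`. Badness persists because a listed
      -- element below `q₁` would be compatible with `c`, as `c ⊴ q₁`.
      ... | q₁ , q₂ , s , t , ¬com = go (h q₁)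
        (All.map (λ ¬com d⊴q → ¬com (q₁ , d⊴q , s)) inc ∷ bad) q₂
        (¬com ∷ All.map (λ ¬com (r , d⊴r , q⊴r) → ¬com (r , d⊴r , ⊴-trans t q⊴r)) inc)
        (⊴-trans p⊴c t)

    -- As long as some configuration is incompatible with all those listed, a decisive one above it
    -- is added. Pairwise incompatible lists are bad, so the bar ends the process.
    decisive-list : Σ[ L ∈ List Conf ] (All Decisive L × (∀ p → Any (λ s → Compatible s p) L))
    decisive-list = go ⊴-bar [] []
      where
      go : ∀ {xs} → Bar _⊴_ xs → Bad _⊴_ xs → All Decisive xs →
        Σ[ L ∈ List Conf ] (All Decisive L × (∀ p → Any (λ s → Compatible s p) L))
      extend-by : ∀ {xs} → (∀ x → Bar _⊴_ (x ∷ xs)) → Bad _⊴_ xs → All Decisive xs →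
        (∃[ p ] ¬ Any (λ s → Compatible s p) xs) →
        Σ[ L ∈ List Conf ] (All Decisive L × (∀ p → Any (λ s → Compatible s p) L))
      go (now h) bad _ = ⊥-elim (h bad)
      go {xs} (later h) bad dec = split em
        where
        split : Dec (∀ p → Any (λ s → Compatible s p) xs) →
          Σ[ L ∈ List Conf ] (All Decisive L × (∀ p → Any (λ s → Compatible s p) L))
        split (yes cov) = xs , dec , cov
        split (no ¬cov) = extend-by h bad dec
          (by-contradiction λ h′ → ¬cov λ p → by-contradiction λ ¬any → h′ (p , ¬any))
      extend-by {xs} h bad dec (p , ¬any) =
        let s , p⊴s , s-dec = decisive-above p
        in go (h s) (All.map (λ ¬com d⊴s → ¬com (s , d⊴s , p⊴s)) (¬Any⇒All¬ xs ¬any) ∷ bad) (s-dec ∷ dec)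

    decisive-cover : ∃[ N ] Σ[ core ∈ (Fin N → Conf) ]
      ((∀ i → Decisive (core i)) × (∀ p → ∃[ i ] Compatible (core i) p))
    decisive-cover =
      let L , dec , cov = decisive-list
      in length L , lookup L , (λ i → All.lookup dec (∈-lookup i)) ,
         λ p → index (cov p) , lookup-index (cov p)

    module Frame {N : ℕ} (core : Fin N → Conf) (core-decisive : ∀ i → Decisive (core i))
      (cover : ∀ p → ∃[ i ] Compatible (core i) p) where

      lab : Fin N → Prime
      lab i = at (core i)

      -- For a decisive core these configurations form a maximal directed down-set.
      In : Fin N → Conf → Set
      In i p = Compatible (core i) p

      In-down : ∀ {i p q} → p ⊴ q → In i q → In i p
      In-down p⊴q (r , i⊴r , q⊴r) = r , i⊴r , ⊴-trans p⊴q q⊴r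

      In-≈ : ∀ {i p} → In i p → lab i ≈ at p
      In-≈ {i} {p} (r , s , t) φ∈ =
        proj₂ (⊴-≈ {p} {r} t φ∈) ∘ proj₁ (⊴-≈ {core i} {r} s φ∈) ,
        proj₂ (⊴-≈ {core i} {r} s φ∈) ∘ proj₁ (⊴-≈ {p} {r} t φ∈)

      upper-bound : ∀ i {n} (p : Fin n → Conf) → (∀ k → core i ⊴ p k) →
        ∃[ q ] (core i ⊴ q × (∀ k → p k ⊴ q))
      upper-bound i {zero}  p above = core i , ⊴-refl , λ ()
      upper-bound i {suc n} p above with upper-bound i (p ∘ suc) (above ∘ suc)
      ... | q , i⊴q , p⊴q with core-decisive i _ _ (above zero) i⊴q
      ... | r , p₀⊴r , q⊴r = r , ⊴-trans i⊴q q⊴r ,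
        λ { zero → p₀⊴r ; (suc k) → ⊴-trans (p⊴q k) q⊴r }

      -- Otherwise each of the finitely many indices fails at some configuration above the core.
      -- Decisiveness gives these failures an upper bound, some index works there, and antitonicity
      -- brings it down to its own failure.
      uniform : ∀ i (R : Conf → Fin N → Set) → (∀ {p q k} → p ⊴ q → R q k → R p k) →
        (∀ p → core i ⊴ p → ∃[ k ] R p k) → ∃[ k ] (∀ p → core i ⊴ p → R p k)
      uniform i R antitone some = by-contradiction λ none →
        let fails : ∀ k → ∃[ p ] (core i ⊴ p × ¬ R p k)
            fails k = by-contradiction λ h →
              none (k , λ p s → by-contradiction λ ¬r → h (p , s , ¬r))
            q , i⊴q , p⊴q = upper-bound i (proj₁ ∘ fails) (proj₁ ∘ proj₂ ∘ fails)
            k , r = some q i⊴q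
        in proj₂ (proj₂ (fails k)) (antitone (p⊴q k) r)

      infix 4 _⊏_ _≼₀_ _≼_

      _⊏_ : Rel (Fin N) 0ℓ
      i ⊏ j = ∃[ T ] ∃[ t ] ∃[ t′ ] (Below (shape T) t t′ × core i ⊴ (T , t) × core j ⊴ (T , t′))

      ⊏-intro : ∀ {i j T t t′} → Below (shape T) t t′ → core i ⊴ (T , t) → In j (T , t′) → i ⊏ j
      ⊏-intro b i⊴ ((T₂ , _) , j⊴ , (f & refl)) =
        T₂ , _ , _ , Hom-Below f b , ⊴-trans i⊴ (f & refl) , j⊴

      ⊏-intro′ : ∀ {i j T t t′} → Below (shape T) t t′ → In i (T , t) → core j ⊴ (T , t′) → i ⊏ j
      ⊏-intro′ b ((T₂ , _) , i⊴ , (f & refl)) j⊴ =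
        T₂ , _ , _ , Hom-Below f b , i⊴ , ⊴-trans j⊴ (f & refl)

      -- Decisiveness of `core i` amalgamates `p` with the tree witnessing `i ⊏ j`, and the path is
      -- transported along. The existential definition of `⊏` is thus witnessed above any
      -- configuration over `core i`.
      ⊏-source : ∀ {i j p} → i ⊏ j → core i ⊴ p →
        ∃[ T ] ∃[ t ] ∃[ t′ ] (Below (shape T) t t′ × p ⊴ (T , t) × core j ⊴ (T , t′))
      ⊏-source {i} (T , t , t′ , b , i⊴ , j⊴) i⊴p with core-decisive i _ _ i⊴ i⊴p
      ... | (T₂ , _) , (f & refl) , p⊴ = T₂ , _ , _ , Hom-Below f b , p⊴ , ⊴-trans j⊴ (f & refl)

      ⊏-target : ∀ {i j q} → i ⊏ j → core j ⊴ q →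
        ∃[ T ] ∃[ t ] ∃[ t′ ] (Below (shape T) t t′ × core i ⊴ (T , t) × q ⊴ (T , t′))
      ⊏-target {_} {j} (T , t , t′ , b , i⊴ , j⊴) j⊴q with core-decisive j _ _ j⊴ j⊴q
      ... | (T₂ , _) , (f & refl) , q⊴ = T₂ , _ , _ , Hom-Below f b , ⊴-trans i⊴ (f & refl) , q⊴

      Moves : Conf → Fin N → Set
      Moves p j = ∃[ T ] ∃[ t ] (p ⊴ (T , t) × Σ[ m ∈ Move (shape T) (world T) ] In j (moved T m , t))

      Moves-down : ∀ {p q j} → p ⊴ q → Moves q j → Moves p j
      Moves-down p⊴q (T , t , q⊴ , m) = T , t , ⊴-trans p⊴q q⊴ , m

      -- Quantifying over everything above the core lets a move be applied to any tree that
      -- witnesses `⊏`. Transitivity comes from `Star`, since a second move would act on an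
      -- enlargement of the tree moved first.
      _≼₀_ _≼_ : Rel (Fin N) 0ℓ
      i ≼₀ j = ∀ p → core i ⊴ p → Moves p j
      _≼_ = Star _≼₀_

      -- A move of a tree raises `t′` together with `t`, so a core compatible with the raised `t′`
      -- can be the target; `uniform` makes it the same for all configurations above `core j`.
      forward₀ : ∀ {i j i′} → i ⊏ j → i ≼₀ i′ → ∃[ j′ ] (j ≼₀ j′ × i′ ⊏ j′)
      forward₀ {i} {j} {i′} i⊏j i≼i′ =
        let j′ , r = uniform j (λ q j′ → Moves q j′ × i′ ⊏ j′)
                       (λ p⊴q (m , r) → Moves-down p⊴q m , r) step
        in j′ , (λ p j⊴p → proj₁ (r p j⊴p)) , proj₂ (r _ ⊴-refl)
        where
        step : ∀ q → core j ⊴ q → ∃[ j′ ] (Moves q j′ × i′ ⊏ j′)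
        step _ j⊴q with ⊏-target i⊏j j⊴q
        ... | T , t , t′ , b , i⊴ , q⊴ with i≼i′ _ i⊴
        ... | T₁ , _ , (g & refl) , m , ((T₂ , _) , i′⊴ , (h & refl)) with cover (T₂ , vertex h (vertex g t′))
        ... | j′ , inj = j′ ,
          (T₁ , vertex g t′ , ⊴-trans q⊴ (g & refl) , m , In-down (h & refl) inj) ,
          ⊏-intro (Hom-Below h (Hom-Below g b)) i′⊴ inj

      backward₀ : ∀ {i j j′} → i ⊏ j → j ≼₀ j′ → ∃[ i′ ] (i ≼₀ i′ × i′ ⊏ j′)
      backward₀ {i} {j} {j′} i⊏j j≼j′ =
        let i′ , r = uniform i (λ p i′ → Moves p i′ × i′ ⊏ j′)
                       (λ p⊴q (m , r) → Moves-down p⊴q m , r) step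
        in i′ , (λ p i⊴p → proj₁ (r p i⊴p)) , proj₂ (r _ ⊴-refl)
        where
        step : ∀ p → core i ⊴ p → ∃[ i′ ] (Moves p i′ × i′ ⊏ j′)
        step _ i⊴p with ⊏-source i⊏j i⊴p
        ... | T , t , t′ , b , p⊴ , j⊴ with j≼j′ _ j⊴
        ... | T₁ , _ , (g & refl) , m , ((T₂ , _) , j′⊴ , (h & refl)) with cover (T₂ , vertex h (vertex g t))
        ... | i′ , ini = i′ ,
          (T₁ , vertex g t , ⊴-trans p⊴ (g & refl) , m , In-down (h & refl) ini) ,
          ⊏-intro′ (Hom-Below h (Hom-Below g b)) ini j′⊴

      forward : ForwardConfluent _≼_ _⊏_
      forward r ε = _ , ε , r
      forward r (s ◅ ss) =
        let _ , s′ , r′ = forward₀ r s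
            k , ss′ , r″ = forward r′ ss
        in k , s′ ◅ ss′ , r″

      backward : BackwardConfluent _≼_ _⊏_
      backward r ε = _ , ε , r
      backward r (s ◅ ss) =
        let _ , s′ , r′ = backward₀ r s
            k , ss′ , r″ = backward r′ ss
        in k , s′ ◅ ss′ , r″

      -- Labels along the relations, and witnesses for the connectives

      ≼₀-lab : ∀ {i j φ} → i ≼₀ j → φ ∈ Φ → lab i ∋ φ → lab j ∋ φ
      ≼₀-lab {i} {j} s φ∈ x with s (core i) ⊴-refl
      ... | T , t , i⊴ , m , inj = proj₂ (In-≈ {j} {moved T m , t} inj φ∈)
        (raises m t (proj₁ (⊴-≈ {core i} {T , t} i⊴ φ∈) x))

      ≼-lab : ∀ {i j φ} → i ≼ j → φ ∈ Φ → lab i ∋ φ → lab j ∋ φ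
      ≼-lab ε        φ∈ x = x
      ≼-lab (s ◅ ss) φ∈ x = ≼-lab ss φ∈ (≼₀-lab s φ∈ x)

      -- `□ φ` is transported along with `φ`, by `□4`, because the final accessibility relation
      -- chains several such steps.
      ⊏-□ : ∀ {i j φ} → i ⊏ j → □ φ ∈ Φ → φ ∈ Φ → lab i ∋ □ φ → lab j ∋ φ × lab j ∋ □ φ
      ⊏-□ {i} {j} (T , t , t′ , b , i⊴ , j⊴) □φ∈ φ∈ x =
        proj₂ (⊴-≈ {core j} {T , t′} j⊴ φ∈) (proj₁ r x′) ,
        proj₂ (⊴-≈ {core j} {T , t′} j⊴ □φ∈) (proj₁ r (closed (world T t) (□4 _ ∙ ax x′)))
        where
        r  = Below-↝ T b
        x′ = proj₁ (⊴-≈ {core i} {T , t} i⊴ □φ∈) x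

      ⊏-◇ : ∀ {i j φ} → i ⊏ j → ◇ φ ∈ Φ → φ ∈ Φ → lab j ∋ φ ⊎ lab j ∋ ◇ φ → lab i ∋ ◇ φ
      ⊏-◇ {i} {j} (T , t , t′ , b , i⊴ , j⊴) ◇φ∈ φ∈ x = proj₂ (⊴-≈ {core i} {T , t} i⊴ ◇φ∈) (go x)
        where
        r = Below-↝ T b
        go : lab j ∋ _ ⊎ lab j ∋ ◇ _ → world T t ∋ ◇ _
        go (inj₁ y) = proj₂ r (proj₁ (⊴-≈ {core j} {T , t′} j⊴ φ∈) y)
        go (inj₂ y) = closed (world T t) (◇4 _ ∙ ax (proj₂ r (proj₁ (⊴-≈ {core j} {T , t′} j⊴ ◇φ∈) y)))

      -- A witness above one world spreads to its whole tree by `move-at`; `uniform` then makes the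
      -- resulting core independent of the configuration.
      ⇒-demand : ∀ {i a b} → a ⇒ b ∈ Φ → a ∈ Φ → b ∈ Φ → ¬ lab i ∋ a ⇒ b →
        ∃[ j ] (i ≼₀ j × lab j ∋ a × ¬ lab j ∋ b)
      ⇒-demand {i} {a} {b} ⇒∈ a∈ b∈ ni =
        let j , r = uniform i (λ p j → Moves p j × lab j ∋ a × ¬ lab j ∋ b)
                      (λ p⊴q (m , r) → Moves-down p⊴q m , r) step
        in j , (λ p i⊴p → proj₁ (r p i⊴p)) , proj₂ (r _ ⊴-refl)
        where
        step : ∀ p → core i ⊴ p → ∃[ j ] (Moves p j × lab j ∋ a × ¬ lab j ∋ b)
        step (T , t) i⊴p =
          let u , t⊑u , ua , ¬ub = ⇒-witness {world T t} (ni ∘ proj₂ (⊴-≈ {core i} {T , t} i⊴p ⇒∈))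
              m , eq = move-at (shape T) (world T) (edge T) t {u} t⊑u
              j , inj = cover (moved T m , t)
          in j , (T , t , ⊴-refl , m , inj) ,
             proj₂ (In-≈ {j} {moved T m , t} inj a∈) (subst (_∋ a) (sym eq) ua) ,
             ¬ub ∘ subst (_∋ b) eq ∘ proj₁ (In-≈ {j} {moved T m , t} inj b∈)

      ◇-demand : ∀ {i a} → a ∈ Φ → lab i ∋ ◇ a → ∃[ j ] (i ⊏ j × lab j ∋ a)
      ◇-demand {i} a∈ x =
        let y , r , ya = ◇-witness {lab i} x
            j , inj = cover (grow (proj₁ (core i)) (proj₂ (core i)) {y} r , zero)
        in j , ⊏-intro [ new ] (grow-Hom _ _ {y} r & refl) inj , proj₂ (In-≈ {j} inj a∈) ya

      □-demand : ∀ {i a} → □ a ∈ Φ → a ∈ Φ → ¬ lab i ∋ □ a →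
        ∃[ i′ ] ∃[ j ] (i ≼₀ i′ × i′ ⊏ j × ¬ lab j ∋ a)
      □-demand {i} {a} □∈ a∈ ni =
        let i′ , r = uniform i R (λ p⊴q (m , r) → Moves-down p⊴q m , r) step
            j , i′⊏j , nj = proj₂ (r _ ⊴-refl)
        in i′ , j , (λ p i⊴p → proj₁ (r p i⊴p)) , i′⊏j , nj
        where
        R : Conf → Fin N → Set
        R p i′ = Moves p i′ × (∃[ j ] (i′ ⊏ j × ¬ lab j ∋ a))
        step : ∀ p → core i ⊴ p → ∃[ i′ ] R p i′
        step (T , t) i⊴p =
          let u , v , t⊑u , u↝v , ¬va =
                □-witness {world T t} (ni ∘ proj₂ (⊴-≈ {core i} {T , t} i⊴p □∈))
              m , eq = move-at (shape T) (world T) (edge T) t {u} t⊑u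
              -- After the move the vertex `t` carries `u`, so `v` can be grafted below it. In `g`
              -- the leaf is `zero` and the old vertex `t` has become `suc t`.
              g = grow (moved T m) t {v} (subst (_↝ v) (sym eq) u↝v)
              i′ , (T₂ , t₂) , i′⊴ , h = cover (g , suc t)
              v₂ = vertex (hom h) zero
              j , inj = cover (T₂ , v₂)
          in i′ ,
             (T , t , ⊴-refl , m , ((T₂ , t₂) , i′⊴ , ⊴-trans (grow-Hom (moved T m) t {v} _ & refl) h)) ,
             j , ⊏-intro (subst (λ w → Below (shape T₂) w v₂) (point h) (vertex-< (hom h) new)) i′⊴ inj ,
             λ y → ¬va (proj₂ (vertex-≈ (hom h) zero a∈) (proj₁ (In-≈ {j} {T₂ , v₂} inj a∈) y))

      _≃_ : Rel (Fin N) 0ℓ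
      i ≃ j = i ≼ j × j ≼ i

      ≃-isEquivalence : IsEquivalence _≃_
      ≃-isEquivalence = record
        { refl  = ε , ε
        ; sym   = λ (p , q) → q , p
        ; trans = λ (p , q) (p′ , q′) → p ◅◅ p′ , q′ ◅◅ q
        }

      -- ⊏₁ is in general not transitive: i ⊏ j, j ≃ j′ and j′ ⊏ k only give a
      -- successor relation from something ≼-above i.
      module Quotient {m : ℕ} (e : Fin m → Fin N) (e-cover : ∀ i → ∃[ k ] i ≃ e k)
        (e-injective : ∀ {k l} → e k ≃ e l → k ≡ l) where

        infix 4 _⊏₁_ _⊏⁺_

        _⊏₁_ _⊏⁺_ : Rel (Fin m) 0ℓ
        k ⊏₁ l = ∃[ i ] ∃[ j ] (i ≃ e k × i ⊏ j × j ≃ e l)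
        _⊏⁺_   = TransClosure _⊏₁_

        ⊏⇒⊏₁ : ∀ {k j} → e k ⊏ j → ∃[ l ] (k ⊏₁ l × j ≃ e l)
        ⊏⇒⊏₁ r = let l , j≃ = e-cover _ in l , (_ , _ , (ε , ε) , r , j≃) , j≃

        ⊏⇒⊏₁′ : ∀ {i l} → i ⊏ e l → ∃[ k ] (k ⊏₁ l × i ≃ e k)
        ⊏⇒⊏₁′ r = let k , i≃ = e-cover _ in k , (_ , _ , i≃ , r , (ε , ε)) , i≃

        forward₁ : ∀ {k l k′} → k ⊏₁ l → e k ≼ e k′ → ∃[ l′ ] (e l ≼ e l′ × k′ ⊏₁ l′)
        forward₁ (_ , _ , (i≼k , _) , r , (_ , l≼j)) k≼k′ =
          let _ , j≼j′ , r′ = forward r (i≼k ◅◅ k≼k′)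
              l′ , s , (j′≼l′ , _) = ⊏⇒⊏₁ r′
          in l′ , l≼j ◅◅ j≼j′ ◅◅ j′≼l′ , s

        backward₁ : ∀ {k l l′} → k ⊏₁ l → e l ≼ e l′ → ∃[ k′ ] (e k ≼ e k′ × k′ ⊏₁ l′)
        backward₁ (_ , _ , (_ , k≼i) , r , (j≼l , _)) l≼l′ =
          let _ , i≼i′ , r′ = backward r (j≼l ◅◅ l≼l′)
              k′ , s , (i′≼k′ , _) = ⊏⇒⊏₁′ r′
          in k′ , k≼i ◅◅ i≼i′ ◅◅ i′≼k′ , s

        forward⁺ : ForwardConfluent (λ k l → e k ≼ e l) _⊏⁺_
        forward⁺ [ r ] s = let l , s′ , r′ = forward₁ r s in l , s′ , [ r′ ]
        forward⁺ (r ∷ rs) s =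
          let _ , s′ , r′  = forward₁ r s
              l , s″ , rs′ = forward⁺ rs s′
          in l , s″ , r′ ∷ rs′

        backward⁺ : BackwardConfluent (λ k l → e k ≼ e l) _⊏⁺_
        backward⁺ [ r ] s = let k , s′ , r′ = backward₁ r s in k , s′ , [ r′ ]
        backward⁺ (r ∷ rs) s =
          let _ , s′ , rs′ = backward⁺ rs s
              k , s″ , r′  = backward₁ r s′
          in k , s″ , r′ ∷ rs′

        model : Model
        model = record
          { ∣_∣               = Fin m
          ; _≼_               = λ k l → e k ≼ e l
          ; _⊏_               = _⊏⁺_
          -- Variables outside `Φ` are made false everywhere, as `≼-lab` guarantees persistence of
          -- labels within `Φ`.
          ; ⟦_⟧               = λ p k → var p ∈ Φ × lab (e k) ∋ var p
          ; ≼-isPartialOrder  = record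
            { isPreorder = record
              { isEquivalence = isEquivalence
              ; reflexive     = λ { refl → ε }
              ; trans         = _◅◅_
              }
            ; antisym = λ p q → e-injective (p , q)
            }
          ; ⊏-transitive      = _++⁺_
          ; forwardConfluent  = forward⁺
          ; backwardConfluent = backward⁺
          ; persistent        = λ (p∈ , x) s → p∈ , ≼-lab s p∈ x
          }

        -- Labels in the quotient and the truth lemma

        ⊏₁-□ : ∀ {k l φ} → k ⊏₁ l → □ φ ∈ Φ → φ ∈ Φ → lab (e k) ∋ □ φ →
          lab (e l) ∋ φ × lab (e l) ∋ □ φ
        ⊏₁-□ (_ , _ , (_ , k≼i) , r , (j≼l , _)) □∈ φ∈ x =
          let y , z = ⊏-□ r □∈ φ∈ (≼-lab k≼i □∈ x) in ≼-lab j≼l φ∈ y , ≼-lab j≼l □∈ z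

        ⊏⁺-□ : ∀ {k l φ} → k ⊏⁺ l → □ φ ∈ Φ → φ ∈ Φ → lab (e k) ∋ □ φ → lab (e l) ∋ φ
        ⊏⁺-□ [ r ]    □∈ φ∈ x = proj₁ (⊏₁-□ r □∈ φ∈ x)
        ⊏⁺-□ (r ∷ rs) □∈ φ∈ x = ⊏⁺-□ rs □∈ φ∈ (proj₂ (⊏₁-□ r □∈ φ∈ x))

        ⊏₁-◇ : ∀ {k l φ} → k ⊏₁ l → ◇ φ ∈ Φ → φ ∈ Φ → lab (e l) ∋ φ ⊎ lab (e l) ∋ ◇ φ →
          lab (e k) ∋ ◇ φ
        ⊏₁-◇ (_ , _ , (i≼k , _) , r , (_ , l≼j)) ◇∈ φ∈ x =
          ≼-lab i≼k ◇∈ (⊏-◇ r ◇∈ φ∈ (Sum.map (≼-lab l≼j φ∈) (≼-lab l≼j ◇∈) x))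

        ⊏⁺-◇ : ∀ {k l φ} → k ⊏⁺ l → ◇ φ ∈ Φ → φ ∈ Φ → lab (e l) ∋ φ → lab (e k) ∋ ◇ φ
        ⊏⁺-◇ [ r ]    ◇∈ φ∈ x = ⊏₁-◇ r ◇∈ φ∈ (inj₁ x)
        ⊏⁺-◇ (r ∷ rs) ◇∈ φ∈ x = ⊏₁-◇ r ◇∈ φ∈ (inj₂ (⊏⁺-◇ rs ◇∈ φ∈ x))

        truth : ∀ φ → subformulas φ ⊆ₗ Φ → ∀ k →
          (model ⊨ φ at k → lab (e k) ∋ φ) × (lab (e k) ∋ φ → model ⊨ φ at k)
        truth (var p) s k = proj₂ , (s (here refl) ,_)
        truth ⊥′ s k = (λ ()) , consistent (lab (e k))
        truth (a ∧ b) s k =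
          (λ (x , y) → closed w (∧-intro (ax (proj₁ (truth a sa k) x)) (ax (proj₁ (truth b sb k) y)))) ,
          λ x → proj₂ (truth a sa k) (closed w (ax-∧E₁ a b ∙ ax x)) ,
                proj₂ (truth b sb k) (closed w (ax-∧E₂ a b ∙ ax x))
          where
          w  = lab (e k)
          sa : subformulas a ⊆ₗ Φ
          sa = s ∘ there ∘ ∈-++⁺ˡ
          sb : subformulas b ⊆ₗ Φ
          sb = s ∘ there ∘ ∈-++⁺ʳ (subformulas a)
        truth (a ∨ b) s k =
          (λ { (inj₁ x) → closed w (ax-∨I₁ a b ∙ ax (proj₁ (truth a sa k) x))
             ; (inj₂ y) → closed w (ax-∨I₂ a b ∙ ax (proj₁ (truth b sb k) y)) }) ,
          λ x → Sum.map (proj₂ (truth a sa k)) (proj₂ (truth b sb k)) (prime w x)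
          where
          w  = lab (e k)
          sa : subformulas a ⊆ₗ Φ
          sa = s ∘ there ∘ ∈-++⁺ˡ
          sb : subformulas b ⊆ₗ Φ
          sb = s ∘ there ∘ ∈-++⁺ʳ (subformulas a)
        truth (a ⇒ b) s k = to , from
          where
          sa : subformulas a ⊆ₗ Φ
          sa = s ∘ there ∘ ∈-++⁺ˡ
          sb : subformulas b ⊆ₗ Φ
          sb = s ∘ there ∘ ∈-++⁺ʳ (subformulas a)
          a∈ = sa (self∈ a)
          b∈ = sb (self∈ b)
          to : model ⊨ a ⇒ b at k → lab (e k) ∋ a ⇒ b
          to h = by-contradiction λ n →
            let j , k≼j , x , ny = ⇒-demand {e k} (s (here refl)) a∈ b∈ n
                -- `j` need not be a representative; the representative `l` of its class has the
                -- same label on `Φ`.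
                l , (j≼l , l≼j) = e-cover j
            in ny (≼-lab l≼j b∈ (proj₁ (truth b sb l)
                 (h l (k≼j ◅ j≼l) (proj₂ (truth a sa l) (≼-lab j≼l a∈ x)))))
          from : lab (e k) ∋ a ⇒ b → model ⊨ a ⇒ b at k
          from x l k≼l y = proj₂ (truth b sb l) (closed (lab (e l))
            (mp (ax (≼-lab k≼l (s (here refl)) x)) (ax (proj₁ (truth a sa l) y))))
        truth (◇ a) s k = to , from
          where
          sa : subformulas a ⊆ₗ Φ
          sa = s ∘ there
          a∈ = sa (self∈ a)
          to : model ⊨ ◇ a at k → lab (e k) ∋ ◇ a
          to (l , r , x) = ⊏⁺-◇ r (s (here refl)) a∈ (proj₁ (truth a sa l) x)
          from : lab (e k) ∋ ◇ a → model ⊨ ◇ a at k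
          from x =
            let j , r , y = ◇-demand {e k} a∈ x
                l , r′ , (j≼l , _) = ⊏⇒⊏₁ r
            in l , [ r′ ] , proj₂ (truth a sa l) (≼-lab j≼l a∈ y)
        truth (□ a) s k = to , from
          where
          sa : subformulas a ⊆ₗ Φ
          sa = s ∘ there
          a∈ = sa (self∈ a)
          to : model ⊨ □ a at k → lab (e k) ∋ □ a
          to h = by-contradiction λ n →
            let i′ , j , k≼i′ , r , ny = □-demand {e k} (s (here refl)) a∈ n
                u , i′≃u = e-cover i′
                v , j≃v  = e-cover j
            in ny (≼-lab (proj₂ j≃v) a∈ (proj₁ (truth a sa v)
                 (h u v (k≼i′ ◅ proj₁ i′≃u) ([ (i′ , j , i′≃u , r , j≃v) ]))))
          from : lab (e k) ∋ □ a → model ⊨ □ a at k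
          from x u v k≼u r =
            proj₂ (truth a sa v) (⊏⁺-□ r (s (here refl)) a∈ (≼-lab k≼u (s (here refl)) x))

theorem15p5 : (∀ ℓ → ExcludedMiddle ℓ) →
    ∀ (φ : 𝕃) → ¬ (IK4⊢ φ) →
    Σ[ M ∈ Model ] (Finite ∣ M ∣ × Σ[ w ∈ ∣ M ∣ ] (¬ (M ⊨ φ at w)))
theorem15p5 lem φ ⊬φ =
  let x , _ , nx = prime-extension em {∅′} (⊬φ ∘ ∅⊢⇒IK4)
      N , core , decisive , cover = decisive-cover
      open Frame core decisive cover
      m , e , e-cover , e-injective = transversal em ≃-isEquivalence
      open Quotient e e-cover e-injective
      -- A core compatible with the one-vertex tree on `x` agrees with `x` on subformulas of `φ`,
      -- hence omits `φ`.
      i , x∈i = cover (singleton em x , zero)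
      k , (i≼k , k≼i) = e-cover i
  in model , (m , ↔-id (Fin m)) , k ,
     λ h → nx (proj₁ (In-≈ x∈i (self∈ φ)) (≼-lab k≼i (self∈ φ) (proj₁ (truth φ id k) h)))
  where
  em : ExcludedMiddle 0ℓ
  em = lem 0ℓ
  open Labelled em (subformulas φ)
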